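{- Disjoint Connected Subgraphs can be solved in $O(3^n k m)$ time, where $n$ and $m$ are the numbers of vertices and edges of the input graph and $k$ is the number of terminal sets.
   Context: A set $S$ of vertices is connected if $G[S]$ is connected. Disjoint Connected Subgraphs: given a graph $G$ and pairwise disjoint vertex sets $Z_1,\dots,Z_k$, decide whether $G$ has pairwise disjoint connected vertex sets $S_1,\dots,S_k$ with $Z_i\subseteq S_i$ for all $i$. -}

module Defs where

open import Data.Bool using (Bool; if_then_else_)
open import Data.Fin as Fin using (Fin; toℕ)
open import Data.Fin.Subset using (Subset; _∈_; _⊆_; _∩_; Empty; Nonempty)
open import Data.List as List using (List; []; _∷_; _++_; length; concatMap; allFin)
open import Data.List.Membership.Propositional using () renaming (_∈_ to _∈ˡ_)
open import Data.List.Relation.Unary.All using (All)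
open import Data.List.Relation.Unary.Unique.Propositional using (Unique)
open import Data.Nat using (ℕ; zero; suc; _+_; _*_; _∸_; _^_; _⊔_; _≤_; _≟_)
open import Data.Product using (_×_; _,_; proj₁; proj₂; ∃-syntax)
open import Data.Sum using (_⊎_)
open import Data.Vec as Vec using ()
open import Relation.Binary.Construct.Closure.ReflexiveTransitive using (Star)
open import Relation.Binary.PropositionalEquality using (_≡_; _≢_)
open import Relation.Nullary using (¬_; does)

-- A finite simple graph.  An edge {u , v} is listed exactly once, with its
-- smaller endpoint first, so that m is the number of edges.

record Graph : Set where
  field
    n       : ℕ
    edges   : List (Fin n × Fin n)
    ordered : All (λ e → proj₁ e Fin.< proj₂ e) edges
    unique  : Unique edges

  m : ℕ
  m = length edges

  Adj : Fin n → Fin n → Set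
  Adj u v = (u , v) ∈ˡ edges ⊎ (v , u) ∈ˡ edges

  -- Adjacency in the induced subgraph G[S].
  AdjIn : Subset n → Fin n → Fin n → Set
  AdjIn S u v = u ∈ S × v ∈ S × Adj u v

  -- The graph without vertices is, as usual, not connected.
  Connected : Subset n → Set
  Connected S = Nonempty S × (∀ {u v} → u ∈ S → v ∈ S → Star (AdjIn S) u v)

PairwiseDisjoint : ∀ {n k} → (Fin k → Subset n) → Set
PairwiseDisjoint S = ∀ {i j} → i ≢ j → Empty (S i ∩ S j)

-- Instances of Disjoint Connected Subgraphs; terminal sets may be empty.

record Instance : Set where
  field
    G        : Graph
  open Graph G public
  field
    k        : ℕ
    Z        : Fin k → Subset n
    disjoint : PairwiseDisjoint Z

YesInstance : Instance → Set
YesInstance I = ∃[ S ] PairwiseDisjoint S × (∀ i → Connected (S i)) × (∀ i → Z i ⊆ S i)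
  where open Instance I

-- Random-access machine with unit-cost operations on words.  A program has
-- finitely many registers (those it mentions) and an addressable memory.
-- There is no multiplication or shift.

Reg : Set
Reg = ℕ

data Program : Set where
  skip              : Program
  _≔const_          : Reg → ℕ → Program
  _≔copy_           : Reg → Reg → Program
  _≔_⊕_ _≔_⊖_       : Reg → Reg → Reg → Program
  _≔load_           : Reg → Reg → Program            -- x := memory[y]
  store_≔_          : Reg → Reg → Program            -- memory[x] := y
  _⨾_               : Program → Program → Program
  ifNonzero_then_else_ : Reg → Program → Program → Program
  whileNonzero_loop_ : Reg → Program → Program

infixr 4 _⨾_
infix  5 _≔const_ _≔copy_ _≔_⊕_ _≔_⊖_ _≔load_ store_≔_
infix  5 ifNonzero_then_else_ whileNonzero_loop_

record State : Set where
  constructor state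
  field
    reg : ℕ → ℕ
    mem : ℕ → ℕ
open State public

update : (ℕ → ℕ) → ℕ → ℕ → (ℕ → ℕ)
update f a v b = if does (b ≟ a) then v else f b

setReg : State → Reg → ℕ → State
setReg σ x v = state (update (reg σ) x v) (mem σ)

setMem : State → ℕ → ℕ → State
setMem σ a v = state (reg σ) (update (mem σ) a v)

-- W ⊢⟨ P , σ ⟩⇓⟨ t , τ ⟩ : on a machine whose words hold the numbers 0 … W,
-- the program P started in σ halts in τ after t steps.  Every elementary
-- operation and every test is one step.  An operation that would overflow a
-- word has no rule; only ≔const and ⊕ can produce a number larger than those
-- already present.

infix 3 _⊢⟨_,_⟩⇓⟨_,_⟩

data _⊢⟨_,_⟩⇓⟨_,_⟩ (W : ℕ) : Program → State → ℕ → State → Set where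
  ⇓skip  : ∀ {σ} → W ⊢⟨ skip , σ ⟩⇓⟨ 1 , σ ⟩
  ⇓const : ∀ {σ x v} → v ≤ W →
           W ⊢⟨ x ≔const v , σ ⟩⇓⟨ 1 , setReg σ x v ⟩
  ⇓copy  : ∀ {σ x y} →
           W ⊢⟨ x ≔copy y , σ ⟩⇓⟨ 1 , setReg σ x (reg σ y) ⟩
  ⇓add   : ∀ {σ x y z} → reg σ y + reg σ z ≤ W →
           W ⊢⟨ x ≔ y ⊕ z , σ ⟩⇓⟨ 1 , setReg σ x (reg σ y + reg σ z) ⟩
  ⇓sub   : ∀ {σ x y z} →
           W ⊢⟨ x ≔ y ⊖ z , σ ⟩⇓⟨ 1 , setReg σ x (reg σ y ∸ reg σ z) ⟩
  ⇓load  : ∀ {σ x y} →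
           W ⊢⟨ x ≔load y , σ ⟩⇓⟨ 1 , setReg σ x (mem σ (reg σ y)) ⟩
  ⇓store : ∀ {σ x y} →
           W ⊢⟨ store x ≔ y , σ ⟩⇓⟨ 1 , setMem σ (reg σ x) (reg σ y) ⟩
  ⇓seq   : ∀ {σ τ υ P Q s t} →
           W ⊢⟨ P , σ ⟩⇓⟨ s , τ ⟩ → W ⊢⟨ Q , τ ⟩⇓⟨ t , υ ⟩ →
           W ⊢⟨ P ⨾ Q , σ ⟩⇓⟨ s + t , υ ⟩
  ⇓then  : ∀ {σ τ x P Q t} → reg σ x ≢ 0 → W ⊢⟨ P , σ ⟩⇓⟨ t , τ ⟩ →
           W ⊢⟨ ifNonzero x then P else Q , σ ⟩⇓⟨ suc t , τ ⟩
  ⇓else  : ∀ {σ τ x P Q t} → reg σ x ≡ 0 → W ⊢⟨ Q , σ ⟩⇓⟨ t , τ ⟩ →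
           W ⊢⟨ ifNonzero x then P else Q , σ ⟩⇓⟨ suc t , τ ⟩
  ⇓stop  : ∀ {σ x P} → reg σ x ≡ 0 →
           W ⊢⟨ whileNonzero x loop P , σ ⟩⇓⟨ 1 , σ ⟩
  ⇓loop  : ∀ {σ τ υ x P s t} → reg σ x ≢ 0 →
           W ⊢⟨ P , σ ⟩⇓⟨ s , τ ⟩ → W ⊢⟨ whileNonzero x loop P , τ ⟩⇓⟨ t , υ ⟩ →
           W ⊢⟨ whileNonzero x loop P , σ ⟩⇓⟨ suc (s + t) , υ ⟩

-- Input: n, m, k, the endpoints of the m edges, and then the characteristic
-- vectors of Z₁, …, Z_k, in consecutive memory cells from address 0.

bit : Bool → ℕ
bit b = if b then 1 else 0

encode : Instance → List ℕ
encode I = n ∷ m ∷ k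
         ∷ concatMap (λ e → toℕ (proj₁ e) ∷ toℕ (proj₂ e) ∷ []) edges
         ++ concatMap (λ i → List.map bit (Vec.toList (Z i))) (allFin k)
  where open Instance I

cell : List ℕ → ℕ → ℕ
cell []       _       = 0
cell (v ∷ _)  zero    = v
cell (_ ∷ vs) (suc a) = cell vs a

initial : Instance → State
initial I = state (λ _ → 0) (cell (encode I))

-- The answer is read from register 0.
CorrectAnswer : Instance → State → Set
CorrectAnswer I τ = (reg τ 0 ≡ 1 × YesInstance I) ⊎ (reg τ 0 ≡ 0 × ¬ YesInstance I)

-- P solves the problem in time O(T), on words of log T + O(1) bits.  T is
-- assumed to dominate n, m and k, so that the input itself fits into words.
SolvesInTimeO : Program → (Instance → ℕ) → Set
SolvesInTimeO P T =
  ∃[ c ] ∀ (I : Instance) →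
    ∃[ t ] ∃[ τ ] (c * T I ⊢⟨ P , initial I ⟩⇓⟨ t , τ ⟩) × t ≤ c * T I × CorrectAnswer I τ

-- 3ⁿ k m, where a factor k or m that is 0 is read as 1: no algorithm runs in
-- 0 steps, so on edgeless graphs or without terminal sets the bound only
-- makes sense this way.
3ⁿkm : Instance → ℕ
3ⁿkm I = 3 ^ n * (k ⊔ 1) * (m ⊔ 1)
  where open Instance I

{-# OPTIONS --safe #-}
module Submission where

open import Data.Bool using (Bool; true; false; if_then_else_; T)
open import Data.Empty using (⊥; ⊥-elim)
open import Data.Fin as Fin using (Fin; zero; suc; toℕ)
open import Data.Fin.Properties as Fin using (any?)
open import Data.Fin.Subset using (Subset; _∈_; _∉_; _⊆_; _∩_; ⁅_⁆; Empty; _⊃_) renaming (⊤ to full; ⊥ to none)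
open import Data.Fin.Subset.Induction using (⊃-wellFounded; Acc; acc)
open import Data.Fin.Subset.Properties using (_∈?_; x∈⁅x⁆; x∈⁅y⁆⇒x≡y; ⊆-antisym; ⊆⊤; x∈p∩q⁺; x∈p∩q⁻)
open import Data.List as List using (List; []; _∷_; _++_; length; concatMap)
open import Data.List.Membership.Propositional using () renaming (_∈_ to _∈ˡ_)
open import Data.List.Properties using (length-++; length-map; length-tabulate)
open import Data.List.Relation.Unary.All as All using ()
open import Data.List.Relation.Unary.Any using (here; there)
open import Data.Nat
open import Data.Nat.Properties
open import Data.Nat.Tactic.RingSolver using (solve-∀)
open import Data.Product using (Σ-syntax; ∃-syntax; _×_; _,_; proj₁; proj₂)
open import Data.Sum using (_⊎_; inj₁; inj₂)
open import Data.Vec as Vec using (Vec; []; _∷_; lookup; _[_]≔_; _[_]=_)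
open import Data.Vec.Properties using (lookup⇒[]=; []=⇒lookup; lookup-map; lookup∘update; lookup∘update′; []≔-lookup; []≔-idempotent; length-toList)
open import Relation.Binary.Construct.Closure.ReflexiveTransitive as Star using (Star; ε; _◅_; _◅◅_)
open import Relation.Binary.Definitions using (tri<; tri≈; tri>)
open import Relation.Binary.PropositionalEquality
open import Relation.Nullary using (¬_; yes; no; does)
open import Relation.Nullary.Decidable using (dec-true; dec-false; _×-dec_; ¬?)
open import Defs

-- Dynamic programming over pairs S ⊆ X of vertex sets, which are coded by n
-- ternary digits.  A set is connected iff it is a singleton or contains an
-- edge uv such that removing v leaves a connected set, so a table of connected
-- sets is filled in increasing order of the bit masks, in time 2ⁿ (n + m).
-- The first i + 1 terminal sets can be served inside X iff some connected
-- S ⊆ X contains Zᵢ₊₁ and the first i can be served inside X ∖ S.  This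
-- property is antitone in i, so one table, holding the largest i for each X,
-- suffices; round i visits all 3ⁿ pairs.

-- A round has only constant time per pair, so neither `Zᵢ₊₁ ⊆ S` nor the connectedness of S can be
-- tested by scanning vertices. The table of pairs therefore serves twice in each round. Pairs whose
-- smaller set is exactly `Zᵢ₊₁` lead to all its supersets, and the connected ones among these are
-- stamped with i + 1. In the second pass the smaller set is the candidate for `Sᵢ₊₁`, and one
-- lookup of its stamp decides whether it is suitable. Stamps are round numbers, so no array is ever
-- cleared. The n in `2ⁿ (n + m)` is not bounded by m, because vertices may be isolated; it is
-- absorbed by the gap between `2ⁿ` and `3ⁿ`. The machine has neither multiplication nor shift, so
-- powers, masks and addresses come from additions, while set difference and the removal of a vertex
-- are subtractions of masks. Since overflow has no rule, every sum must be bounded by the word size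
-- as part of correctness.

update-same : ∀ f a v → update f a v a ≡ v
update-same f a v = cong (if_then v else f a) (dec-true (a ≟ a) refl)

update-other : ∀ f a v {b} → b ≢ a → update f a v b ≡ f b
update-other f a v {b} b≢a = cong (if_then v else f b) (dec-false (b ≟ a) b≢a)

update-cong : ∀ {f g} a {v w} b → f b ≡ g b → v ≡ w → update f a v b ≡ update g a w b
update-cong a b f≡g v≡w with does (b ≟ a)
... | true = v≡w
... | false = f≡g

-- Register files are lists read with cell, so writing beyond the end pads with zeros.
put : List ℕ → ℕ → ℕ → List ℕ
put []       zero    v = v ∷ []
put []       (suc x) v = 0 ∷ put [] x v
put (_ ∷ vs) zero    v = v ∷ vs
put (u ∷ vs) (suc x) v = u ∷ put vs x v

cell-put : ∀ vs x v r → cell (put vs x v) r ≡ update (cell vs) x v r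
cell-put []       zero    v zero    = refl
cell-put []       zero    v (suc r) = refl
cell-put []       (suc x) v zero    = refl
cell-put []       (suc x) v (suc r) = cell-put [] x v r
cell-put (_ ∷ vs) zero    v zero    = refl
cell-put (_ ∷ vs) zero    v (suc r) = refl
cell-put (_ ∷ vs) (suc x) v zero    = refl
cell-put (_ ∷ vs) (suc x) v (suc r) = cell-put vs x v r

-- Program logic for the machine, with running times.

-- Memory is viewed as a read-only input below address D, followed by arrays
-- of common length L.  With literal array numbers, frame conditions between
-- different arrays hold by computation.
module Machine (W D L : ℕ) (inp : ℕ → ℕ) where

  Heap : Set
  Heap = ℕ → ℕ → ℕ

  -- The conditional chooses between two functions, outside the application to an index, so for
  -- distinct literals `write h a i v b` reduces to `h b` itself.
  write : Heap → ℕ → ℕ → ℕ → Heap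
  write h a i v b = if does (b ≟ a) then update (h b) i v else h b

  write-same : ∀ h a i v j → write h a i v a j ≡ update (h a) i v j
  write-same h a i v j = cong (λ c → (if c then update (h a) i v else h a) j) (dec-true (a ≟ a) refl)

  write-other : ∀ h a i v {b} → b ≢ a → ∀ j → write h a i v b j ≡ h b j
  write-other h a i v {b} b≢a j = cong (λ c → (if c then update (h b) i v else h b) j) (dec-false (b ≟ a) b≢a)

  base : ℕ → ℕ
  base zero    = D
  base (suc a) = base a + L

  -- A store has to name a `Slot`, which excludes the input region, while a load may use any `Loc`.
  -- Hence the input stays available for rereading.
  data Slot : ℕ → Set where
    slot : ∀ a i → i < L → Slot (base a + i)

  data Loc : ℕ → Set where
    input : ∀ {p} → p < D → Loc p
    array : ∀ a i → i < L → Loc (base a + i)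

  read : ∀ {p} → Heap → Loc p → ℕ
  read h (input {p} _) = inp p
  read h (array a i _) = h a i

  writeAt : ∀ {p} → Heap → Slot p → ℕ → Heap
  writeAt h (slot a i _) v = write h a i v

  base-mono : ∀ {a b} → a ≤′ b → base a ≤ base b
  base-mono ≤′-refl = ≤-refl
  base-mono (≤′-step a≤b) = ≤-trans (base-mono a≤b) (m≤m+n _ L)

  base-< : ∀ {a b i} j → a < b → i < L → base a + i < base b + j
  base-< {a} {b} {i} j a<b i<L = begin-strict
    base a + i    <⟨ +-monoʳ-< (base a) i<L ⟩
    base (suc a)  ≤⟨ base-mono (≤⇒≤′ a<b) ⟩
    base b        ≤⟨ m≤m+n (base b) j ⟩
    base b + j    ∎
    where open ≤-Reasoning

  base-≢ : ∀ {a b i j} → a ≢ b → i < L → j < L → base a + i ≢ base b + j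
  base-≢ {a} {b} {i} {j} a≢b i<L j<L eq with <-cmp a b
  ... | tri< a<b _ _ = <⇒≢ (base-< j a<b i<L) eq
  ... | tri≈ _ a≡b _ = a≢b a≡b
  ... | tri> _ _ b<a = <⇒≢ (base-< i b<a j<L) (sym eq)

  D≤base : ∀ a i → D ≤ base a + i
  D≤base a i = ≤-trans (base-mono (≤⇒≤′ (z≤n {a}))) (m≤m+n _ i)

  record Represents (σ : State) (vs : List ℕ) (h : Heap) : Set where
    constructor represents
    field
      regs   : ∀ r → reg σ r ≡ cell vs r
      inputs : ∀ p → p < D → mem σ p ≡ inp p
      arrays : ∀ a i → i < L → mem σ (base a + i) ≡ h a i

  open Represents

  setReg-represents : ∀ {σ vs h} x {v w} → v ≡ w → Represents σ vs h →
                      Represents (setReg σ x v) (put vs x w) h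
  setReg-represents {σ} {vs} x {v} {w} v≡w ρ = represents
    (λ r → trans (update-cong {reg σ} {cell vs} x r (regs ρ r) v≡w) (sym (cell-put vs x w r)))
    (inputs ρ) (arrays ρ)

  setMem-represents : ∀ {σ vs h p q v w} (s : Slot q) → p ≡ q → v ≡ w → Represents σ vs h →
                      Represents (setMem σ p v) vs (writeAt h s w)
  setMem-represents {σ} {vs} {h} {v = v} (slot a i i<L) refl refl ρ = represents (regs ρ)
    (λ p p<D → trans (update-other (mem σ) _ v (λ { refl → <⇒≱ p<D (D≤base a i) })) (inputs ρ p p<D))
    new
    where
    new : ∀ b j → j < L → update (mem σ) (base a + i) v (base b + j) ≡ write h a i v b j
    new b j j<L with b ≟ a
    ... | no b≢a = trans (update-other (mem σ) _ v (base-≢ b≢a j<L i<L)) (trans (arrays ρ b j j<L) (sym (write-other h a i v b≢a j)))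
    ... | yes refl with j ≟ i
    ...   | yes refl = trans (update-same (mem σ) _ v) (sym (trans (write-same h a i v i) (update-same (h a) i v)))
    ...   | no j≢i = trans (update-other (mem σ) _ v (λ eq → j≢i (+-cancelˡ-≡ (base a) j i eq)))
                       (trans (arrays ρ a j j<L) (sym (trans (write-same h a i v j) (update-other (h a) i v j≢i))))

  read-represents : ∀ {σ vs h p q} (l : Loc q) → p ≡ q → Represents σ vs h → mem σ p ≡ read h l
  read-represents (input p<D) refl ρ = inputs ρ _ p<D
  read-represents (array a i i<L) refl ρ = arrays ρ a i i<L

  Post : Set₁
  Post = List ℕ → Heap → Set

  record Halts (P : Program) (σ : State) (t : ℕ) (Q : Post) : Set where
    constructor halts
    field
      {time}  : ℕ
      {final} : State
      {vals}  : List ℕ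
      {heap}  : Heap
      runs    : W ⊢⟨ P , σ ⟩⇓⟨ time , final ⟩
      bound   : time ≤ t
      repr    : Represents final vals heap
      post    : Q vals heap

  Runs : Program → List ℕ → Heap → ℕ → Post → Set
  Runs P vs h t Q = ∀ σ → Represents σ vs h → Halts P σ t Q

  -- Weakest preconditions of loop-free programs; cost bounds their time.  The
  -- assigned values are left to the prover: substituting cell vs y into vs
  -- would make the unfolded precondition exponentially large.
  wp : Program → Post → Post
  wp skip          Q vs h = Q vs h
  wp (x ≔const v)  Q vs h = v ≤ W × Q (put vs x v) h
  wp (x ≔copy y)   Q vs h = ∃[ v ] v ≡ cell vs y × Q (put vs x v) h
  wp (x ≔ y ⊕ z)   Q vs h = ∃[ v ] v ≡ cell vs y + cell vs z × v ≤ W × Q (put vs x v) h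
  wp (x ≔ y ⊖ z)   Q vs h = ∃[ v ] v ≡ cell vs y ∸ cell vs z × Q (put vs x v) h
  wp (x ≔load y)   Q vs h = Σ[ l ∈ Loc (cell vs y) ] ∃[ v ] v ≡ read h l × Q (put vs x v) h
  wp (store x ≔ y) Q vs h = Σ[ s ∈ Slot (cell vs x) ] Q vs (writeAt h s (cell vs y))
  wp (P ⨾ P′)      Q vs h = wp P (wp P′ Q) vs h
  wp (ifNonzero x then P else P′) Q vs h =
    (cell vs x ≢ 0 → wp P Q vs h) × (cell vs x ≡ 0 → wp P′ Q vs h)
  wp (whileNonzero x loop P) Q vs h = ⊥

  cost : Program → ℕ
  cost (P ⨾ P′) = cost P + cost P′
  cost (ifNonzero x then P else P′) = suc (cost P ⊔ cost P′)
  cost _ = 1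

  seq : ∀ {P P′ vs h s t Q} → Runs P vs h s (λ vs′ h′ → Runs P′ vs′ h′ t Q) → Runs (P ⨾ P′) vs h (s + t) Q
  seq r σ ρ with r σ ρ
  ... | halts r₁ b₁ ρ₁ k with k _ ρ₁
  ...   | halts r₂ b₂ ρ₂ q = halts (⇓seq r₁ r₂) (+-mono-≤ b₁ b₂) ρ₂ q

  consequence : ∀ {P vs h t} {Q Q′ : Post} → (∀ {vs h} → Q vs h → Q′ vs h) → Runs P vs h t Q → Runs P vs h t Q′
  consequence f r σ ρ with r σ ρ
  ... | halts r₁ b₁ ρ₁ q = halts r₁ b₁ ρ₁ (f q)

  block : ∀ P {vs h Q} → wp P Q vs h → Runs P vs h (cost P) Q
  block skip q σ ρ = halts ⇓skip ≤-refl ρ q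
  block (x ≔const v) (b , q) σ ρ = halts (⇓const b) ≤-refl (setReg-represents x refl ρ) q
  block (x ≔copy y) (_ , eq , q) σ ρ = halts ⇓copy ≤-refl (setReg-represents x (trans (regs ρ y) (sym eq)) ρ) q
  block (x ≔ y ⊕ z) (_ , eq , b , q) σ ρ =
    halts (⇓add (subst (_≤ W) (sym eq′) b)) ≤-refl (setReg-represents x eq′ ρ) q
    where eq′ = trans (cong₂ _+_ (regs ρ y) (regs ρ z)) (sym eq)
  block (x ≔ y ⊖ z) (_ , eq , q) σ ρ =
    halts ⇓sub ≤-refl (setReg-represents x (trans (cong₂ _∸_ (regs ρ y) (regs ρ z)) (sym eq)) ρ) q
  block (x ≔load y) (l , _ , eq , q) σ ρ =
    halts ⇓load ≤-refl (setReg-represents x (trans (read-represents l (regs ρ y) ρ) (sym eq)) ρ) q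
  block (store x ≔ y) (s , q) σ ρ = halts ⇓store ≤-refl (setMem-represents s (regs ρ x) (regs ρ y) ρ) q
  block (P ⨾ P′) w = seq {P} {P′} (consequence {P} (block P′) (block P w))
  block (ifNonzero x then P else P′) (w₁ , w₂) σ ρ with reg σ x ≟ 0
  ... | yes z with block P′ (w₂ (trans (sym (regs ρ x)) z)) σ ρ
  ...   | halts r b ρ′ q = halts (⇓else z r) (s≤s (≤-trans b (m≤n⊔m (cost P) _))) ρ′ q
  block (ifNonzero x then P else P′) (w₁ , w₂) σ ρ | no nz with block P (w₁ (λ z → nz (trans (regs ρ x) z))) σ ρ
  ...   | halts r b ρ′ q = halts (⇓then nz r) (s≤s (≤-trans b (m≤m⊔n (cost P) _))) ρ′ q

  -- T j bounds the time when j iterations remain.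
  while : ∀ {x P} (Inv : ℕ → Post) (T : ℕ → ℕ) → 1 ≤ T 0 →
          (∀ {vs h} → Inv 0 vs h → cell vs x ≡ 0) →
          (∀ j {vs h} → Inv (suc j) vs h →
             cell vs x ≢ 0 × (Σ[ t ∈ ℕ ] suc (t + T j) ≤ T (suc j) × Runs P vs h t (Inv j))) →
          ∀ j {vs h} → Inv j vs h → Runs (whileNonzero x loop P) vs h (T j) (Inv 0)
  while Inv T T₀ done step zero i σ ρ = halts (⇓stop (trans (regs ρ _) (done i))) T₀ ρ i
  while Inv T T₀ done step (suc j) i σ ρ with step j i
  ... | nz , t , Tₛ , body with body σ ρ
  ... | halts r b ρ′ i′ with while Inv T T₀ done step j i′ _ ρ′
  ... | halts r′ b′ ρ″ q =
    halts (⇓loop (λ z → nz (trans (sym (regs ρ _)) z)) r r′) (≤-trans (s≤s (+-mono-≤ b b′)) Tₛ) ρ″ q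

  for : ∀ {x P} (Inv : ℕ → Post) (t : ℕ) →
        (∀ {vs h} → Inv 0 vs h → cell vs x ≡ 0) →
        (∀ j {vs h} → Inv (suc j) vs h → cell vs x ≢ 0 × Runs P vs h t (Inv j)) →
        ∀ j {vs h} → Inv j vs h → Runs (whileNonzero x loop P) vs h (1 + j * suc t) (Inv 0)
  for Inv t done step = while Inv (λ j → 1 + j * suc t) ≤-refl done
    (λ j i → let nz , body = step j i in nz , t , s≤s (≤-reflexive (+-suc t (j * suc t))) , body)

-- Powers of two and three.

2^ : ℕ → ℕ
2^ zero    = 1
2^ (suc v) = 2^ v + 2^ v

3^ : ℕ → ℕ
3^ zero    = 1
3^ (suc v) = 3^ v + (3^ v + 3^ v)

1≤2^ : ∀ v → 1 ≤ 2^ v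
1≤2^ zero    = ≤-refl
1≤2^ (suc v) = ≤-trans (1≤2^ v) (m≤m+n _ _)

2^≤3^ : ∀ v → 2^ v ≤ 3^ v
2^≤3^ zero    = ≤-refl
2^≤3^ (suc v) = +-mono-≤ (2^≤3^ v) (≤-trans (2^≤3^ v) (m≤m+n _ _))

v<2^ : ∀ v → v < 2^ v
v<2^ zero    = ≤-refl
v<2^ (suc v) = ≤-trans (s≤s (v<2^ v)) (+-monoˡ-≤ (2^ v) (1≤2^ v))

2^-mono-< : ∀ {v w} → v < w → 2^ v < 2^ w
2^-mono-< {v} v<w = go (≤⇒≤′ v<w)
  where
  go : ∀ {w} → suc v ≤′ w → 2^ v < 2^ w
  go ≤′-refl = +-monoˡ-≤ (2^ v) (1≤2^ v)
  go (≤′-step q) = ≤-trans (go q) (m≤m+n _ _)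

3^-mono-≤ : ∀ {v w} → v ≤ w → 3^ v ≤ 3^ w
3^-mono-≤ {v} v≤w = go (≤⇒≤′ v≤w)
  where
  go : ∀ {w} → v ≤′ w → 3^ v ≤ 3^ w
  go ≤′-refl = ≤-refl
  go (≤′-step q) = ≤-trans (go q) (m≤m+n _ _)

3^≡3^ : ∀ v → 3^ v ≡ 3 ^ v
3^≡3^ zero    = refl
3^≡3^ (suc v) rewrite 3^≡3^ v = cong (λ x → 3 ^ v + (3 ^ v + x)) (sym (+-identityʳ _))

-- This pays for decoding each of the `2ⁿ` masks in n iterations when the graph has far fewer edges
-- than vertices.
2^v*v≤2*3^v : ∀ v → 2^ v * v ≤ 3^ v + 3^ v
2^v*v≤2*3^v v = ≤-trans (m≤n+m _ (2^ v + 2^ v)) (go v)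
  where
  -- The stronger claim `2^ v * (v + 2) ≤ 2 * 3^ v` is inductive: doubling it leaves room for
  -- `2 * 3^ v` on the right, which covers the additional `2 * 2^ v` on the left.
  go : ∀ v → 2^ v + 2^ v + 2^ v * v ≤ 3^ v + 3^ v
  go zero    = ≤-refl
  go (suc v) = begin
    (b + b) + (b + b) + (b + b) * suc v      ≡⟨ lem b v ⟩
    (b + b + b * v) + (b + b + b * v) + (b + b) ≤⟨ +-mono-≤ (+-mono-≤ (go v) (go v)) (+-mono-≤ (2^≤3^ v) (2^≤3^ v)) ⟩
    (c + c) + (c + c) + (c + c)              ≡⟨ lem′ c ⟩
    (c + (c + c)) + (c + (c + c))            ∎
    where
    open ≤-Reasoning
    b = 2^ v
    c = 3^ v
    lem : ∀ b v → (b + b) + (b + b) + (b + b) * suc v ≡ (b + b + b * v) + (b + b + b * v) + (b + b)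
    lem = solve-∀
    lem′ : ∀ c → (c + c) + (c + c) + (c + c) ≡ (c + (c + c)) + (c + (c + c))
    lem′ = solve-∀

-- Binary masks of sets and ternary codes of pairs.

-- The first vertex is the most significant digit.
val : ∀ {v} → Subset v → ℕ
val []                  = 0
val (false ∷ s)         = val s
val {suc v} (true ∷ s)  = val s + 2^ v

val<2^ : ∀ {v} (s : Subset v) → val s < 2^ v
val<2^ []          = ≤-refl
val<2^ (false ∷ s) = ≤-trans (val<2^ s) (m≤m+n _ _)
val<2^ (true ∷ s)  = +-monoˡ-< _ (val<2^ s)

val-surjective : ∀ v {x} → x < 2^ v → ∃[ s ] val {v} s ≡ x
val-surjective zero {zero} _ = [] , refl
val-surjective zero {suc x} (s≤s ())
val-surjective (suc v) {x} x< with x <? 2^ v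
... | yes p = let s , eq = val-surjective v p in false ∷ s , eq
... | no p = let s , eq = val-surjective v (+-cancelʳ-< (2^ v) (x ∸ 2^ v) (2^ v) (subst (_< 2^ v + 2^ v) (sym (m∸n+n≡m (≮⇒≥ p))) x<))
             in true ∷ s , trans (cong (_+ 2^ v) eq) (m∸n+n≡m (≮⇒≥ p))

val-injective : ∀ {v} (s t : Subset v) → val s ≡ val t → s ≡ t
val-injective []          []          _  = refl
val-injective (false ∷ s) (false ∷ t) eq = cong (false ∷_) (val-injective s t eq)
val-injective (true ∷ s)  (true ∷ t)  eq = cong (true ∷_) (val-injective s t (+-cancelʳ-≡ _ (val s) (val t) eq))
val-injective (false ∷ s) (true ∷ t)  eq = ⊥-elim (<⇒≱ (val<2^ s) (≤-trans (m≤n+m _ (val t)) (≤-reflexive (sym eq))))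
val-injective (true ∷ s)  (false ∷ t) eq = ⊥-elim (<⇒≱ (val<2^ t) (≤-trans (m≤n+m _ (val s)) (≤-reflexive eq)))

val-none : ∀ v → val (none {v}) ≡ 0
val-none zero    = refl
val-none (suc v) = val-none v

val-full : ∀ v → suc (val (full {v})) ≡ 2^ v
val-full zero    = refl
val-full (suc v) = cong (_+ 2^ v) (val-full v)

-- `remove` is what lets the machine delete a vertex from a set by one subtraction. `position` is
-- additive to avoid truncated subtraction, and it identifies the weight with the power of two that
-- the program stores for u.
record Weight {n : ℕ} (u : Fin n) : Set where
  field
    weight    : ℕ
    position  : toℕ u + suc weight ≡ n
    singleton : val ⁅ u ⁆ ≡ 2^ weight
    remove    : ∀ X → lookup X u ≡ true → val X ≡ val (X [ u ]≔ false) + 2^ weight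

weigh : ∀ {n} (u : Fin n) → Weight u
weigh {suc n} zero = record
  { weight = n ; position = refl ; singleton = cong (_+ 2^ n) (val-none n)
  ; remove = λ { (true ∷ X) _ → refl } }
weigh {suc n} (suc u) = record
  { weight = weight ; position = cong suc position ; singleton = singleton
  ; remove = λ { (false ∷ X) eq → remove X eq
               ; (true ∷ X) eq → trans (cong (_+ 2^ n) (remove X eq)) (swap (val (X [ u ]≔ false)) (2^ weight) (2^ n)) } }
  where
  open Weight (weigh u)
  swap : ∀ a b c → a + b + c ≡ a + c + b
  swap = solve-∀

-- The digits of (X , S) with S ⊆ X: a vertex lies outside X, in X ∖ S, or in S.
data Digit : Set where
  outer rest inner : Digit

code : ∀ {v} → Vec Digit v → ℕ
code []                  = 0
code (outer ∷ d)         = code d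
code {suc v} (rest ∷ d)  = code d + 3^ v
code {suc v} (inner ∷ d) = code d + 3^ v + 3^ v

code<3^ : ∀ {v} (d : Vec Digit v) → code d < 3^ v
code<3^ [] = ≤-refl
code<3^ (outer ∷ d) = ≤-trans (code<3^ d) (m≤m+n _ _)
code<3^ {suc v} (rest ∷ d) = ≤-trans (+-monoˡ-< (3^ v) (code<3^ d)) (+-monoʳ-≤ (3^ v) (m≤m+n _ _))
code<3^ {suc v} (inner ∷ d) = subst (code d + 3^ v + 3^ v <_) (+-assoc (3^ v) _ _)
  (+-monoˡ-< (3^ v) (+-monoˡ-< (3^ v) (code<3^ d)))

code-surjective : ∀ v {t} → t < 3^ v → ∃[ d ] code {v} d ≡ t
code-surjective zero {zero} _ = [] , refl
code-surjective zero {suc t} (s≤s ())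
code-surjective (suc v) {t} t< with t <? 3^ v
... | yes p = let d , eq = code-surjective v p in outer ∷ d , eq
... | no p with t ∸ 3^ v <? 3^ v
...   | yes q = let d , eq = code-surjective v q in rest ∷ d , trans (cong (_+ 3^ v) eq) (m∸n+n≡m (≮⇒≥ p))
...   | no q = let d , eq = code-surjective v r in inner ∷ d , trans (cong (λ z → z + 3^ v + 3^ v) eq) e₂
  where
  a = t ∸ 3^ v ∸ 3^ v
  e₂ : a + 3^ v + 3^ v ≡ t
  e₂ = trans (cong (_+ 3^ v) (m∸n+n≡m (≮⇒≥ q))) (m∸n+n≡m (≮⇒≥ p))
  r : a < 3^ v
  r = +-cancelʳ-< (3^ v) a (3^ v) (+-cancelʳ-< (3^ v) (a + 3^ v) (3^ v + 3^ v)
        (subst₂ _<_ (sym e₂) (sym (+-assoc (3^ v) _ _)) t<))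

union sel diff : Digit → Bool
union outer = false
union _     = true
sel inner = true
sel _     = false
diff rest = true
diff _    = false

Union Sel Diff : ∀ {v} → Vec Digit v → Subset v
Union = Vec.map union
Sel   = Vec.map sel
Diff  = Vec.map diff

-- Because S is contained in X, the binary subtraction never borrows, so a single `⊖` of masks
-- computes the set difference.
val-Diff : ∀ {v} (d : Vec Digit v) → val (Union d) ≡ val (Diff d) + val (Sel d)
val-Diff []          = refl
val-Diff (outer ∷ d) = val-Diff d
val-Diff {suc v} (rest ∷ d) = trans (cong (_+ 2^ v) (val-Diff d))
  (trans (+-assoc (val (Diff d)) _ _) (trans (cong (val (Diff d) +_) (+-comm (val (Sel d)) _)) (sym (+-assoc (val (Diff d)) _ _))))
val-Diff {suc v} (inner ∷ d) = trans (cong (_+ 2^ v) (val-Diff d)) (+-assoc (val (Diff d)) _ _)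

∈⇒lookup : ∀ {n} {X : Subset n} {u} → u ∈ X → lookup X u ≡ true
∈⇒lookup = []=⇒lookup

lookup⇒∈ : ∀ {n} {X : Subset n} {u} → lookup X u ≡ true → u ∈ X
lookup⇒∈ {X = X} {u} = lookup⇒[]= u X

Sel⊆Union : ∀ {v} (d : Vec Digit v) → Sel d ⊆ Union d
Sel⊆Union d {u} u∈ with lookup d u | lookup-map u sel d | lookup-map u union d
... | inner | _ | eq = lookup⇒∈ eq
... | outer | eq | _ with () ← trans (sym (∈⇒lookup u∈)) eq
... | rest  | eq | _ with () ← trans (sym (∈⇒lookup u∈)) eq

Diff⊆Union : ∀ {v} (d : Vec Digit v) → Diff d ⊆ Union d
Diff⊆Union d {u} u∈ with lookup d u | lookup-map u diff d | lookup-map u union d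
... | rest  | _ | eq = lookup⇒∈ eq
... | outer | eq | _ with () ← trans (sym (∈⇒lookup u∈)) eq
... | inner | eq | _ with () ← trans (sym (∈⇒lookup u∈)) eq

Diff∌Sel : ∀ {v} (d : Vec Digit v) {u} → u ∈ Diff d → u ∉ Sel d
Diff∌Sel d {u} u∈ u∈′ with lookup d u | lookup-map u diff d | lookup-map u sel d
... | rest  | _ | eq with () ← trans (sym (∈⇒lookup u∈′)) eq
Diff∌Sel d {u} u∈ u∈′ | outer | eq | _ with () ← trans (sym (∈⇒lookup u∈)) eq
Diff∌Sel d {u} u∈ u∈′ | inner | eq | _ with () ← trans (sym (∈⇒lookup u∈)) eq

∈Union : ∀ {v} (d : Vec Digit v) {u} → u ∈ Union d → u ∉ Sel d → u ∈ Diff d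
∈Union d {u} u∈ u∉ with lookup d u | lookup-map u diff d | lookup-map u sel d | lookup-map u union d
... | rest  | eq | _  | _  = lookup⇒∈ eq
... | inner | _  | eq | _  = ⊥-elim (u∉ (lookup⇒∈ eq))
... | outer | _  | _  | eq with () ← trans (sym (∈⇒lookup u∈)) eq

digits : ∀ {v} (X S : Subset v) → S ⊆ X → Σ[ d ∈ Vec Digit v ] Union d ≡ X × Sel d ≡ S
digits []          []          S⊆X = [] , refl , refl
digits (x ∷ X) (s ∷ S) S⊆X with digits X S (λ p → drop (S⊆X (_[_]=_.there p)))
  where
  drop : ∀ {u} → suc u ∈ (x ∷ X) → u ∈ X
  drop (_[_]=_.there p) = p
digits (false ∷ X) (false ∷ S) S⊆X | d , eq , eq′ = outer ∷ d , cong (false ∷_) eq , cong (false ∷_) eq′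
digits (true ∷ X)  (false ∷ S) S⊆X | d , eq , eq′ = rest ∷ d , cong (true ∷_) eq , cong (false ∷_) eq′
digits (true ∷ X)  (true ∷ S)  S⊆X | d , eq , eq′ = inner ∷ d , cong (true ∷_) eq , cong (true ∷_) eq′
digits (false ∷ X) (true ∷ S)  S⊆X | d , eq , eq′ with () ← S⊆X _[_]=_.here

-- Characteristic vectors and concatenated lists of cells.

χ : ∀ {v} → Subset v → ℕ → ℕ
χ s = cell (List.map bit (Vec.toList s))

χ-lookup : ∀ {v} (s : Subset v) u → χ s (toℕ u) ≡ bit (lookup s u)
χ-lookup (b ∷ s) zero    = refl
χ-lookup (b ∷ s) (suc u) = χ-lookup s u

χ⇒lookup : ∀ {v} (s : Subset v) u → χ s (toℕ u) ≢ 0 → lookup s u ≡ true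
χ⇒lookup s u nz with lookup s u | χ-lookup s u
... | true  | _  = refl
... | false | eq = ⊥-elim (nz eq)

lookup⇒χ : ∀ {v} (s : Subset v) u → lookup s u ≡ true → χ s (toℕ u) ≢ 0
lookup⇒χ s u eq z with () ← trans (sym (trans (χ-lookup s u) (cong bit eq))) z

cell-++ : ∀ xs ys p → cell (xs ++ ys) (length xs + p) ≡ cell ys p
cell-++ []       ys p = refl
cell-++ (x ∷ xs) ys p = cell-++ xs ys p

cell-++ˡ : ∀ xs ys {p} → p < length xs → cell (xs ++ ys) p ≡ cell xs p
cell-++ˡ (x ∷ xs) ys {zero}  _       = refl
cell-++ˡ (x ∷ xs) ys {suc p} (s≤s q) = cell-++ˡ xs ys q

cell-beyond : ∀ xs {p} → length xs ≤ p → cell xs p ≡ 0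
cell-beyond []       _       = refl
cell-beyond (x ∷ xs) (s≤s q) = cell-beyond xs q

module _ {A : Set} (f : A → List ℕ) {n : ℕ} (uniform : ∀ x → length (f x) ≡ n) where

  cell-concatMap : ∀ {k} (g : Fin k → A) i {p} → p < n →
                   cell (concatMap f (List.tabulate g)) (toℕ i * n + p) ≡ cell (f (g i)) p
  cell-concatMap g zero    p<n = cell-++ˡ (f (g zero)) _ (subst (_ <_) (sym (uniform (g zero))) p<n)
  cell-concatMap g (suc i) {p} p<n = trans
    (cong (cell (f (g zero) ++ _)) (trans (+-assoc n _ p) (cong (_+ (toℕ i * n + p)) (sym (uniform (g zero))))))
    (trans (cell-++ (f (g zero)) _ _) (cell-concatMap (λ j → g (suc j)) i p<n))

  length-concatMap : ∀ xs → length (concatMap f xs) ≡ length xs * n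
  length-concatMap []       = refl
  length-concatMap (x ∷ xs) = trans (length-++ (f x)) (cong₂ _+_ (uniform x) (length-concatMap xs))

-- Connected sets, packings of terminal sets, and the layout of the input.

module Logic (I : Instance) where
  open Instance I

  -- With the removal in the premise instead of an insertion in the conclusion, `grow` applies to
  -- any X, and its premise concerns a set with a smaller mask, whose table entry is already final.
  data Built : Subset n → Set where
    single : ∀ u → Built ⁅ u ⁆
    grow   : ∀ {X} u v → lookup X u ≡ true → lookup X v ≡ true → Adj u v → Built (X [ v ]≔ false) → Built X

  Adj-sym : ∀ {u v} → Adj u v → Adj v u
  Adj-sym (inj₁ p) = inj₂ p
  Adj-sym (inj₂ p) = inj₁ p

  Adj-irreflexive : ∀ {u} → ¬ Adj u u
  Adj-irreflexive (inj₁ p) = <-irrefl refl (All.lookup ordered p)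
  Adj-irreflexive (inj₂ p) = <-irrefl refl (All.lookup ordered p)

  remove⊆ : ∀ (X : Subset n) v → X [ v ]≔ false ⊆ X
  remove⊆ X v {u} u∈ with u Fin.≟ v
  ... | yes refl with () ← trans (sym (∈⇒lookup u∈)) (lookup∘update v X false)
  ... | no u≢v = lookup⇒∈ (trans (sym (lookup∘update′ u≢v X false)) (∈⇒lookup u∈))

  Star-sym : ∀ {X u v} → Star (AdjIn X) u v → Star (AdjIn X) v u
  Star-sym = Star.reverse (λ (p , q , a) → q , p , Adj-sym a)

  Built⇒Connected : ∀ {X} → Built X → Connected X
  Built⇒Connected (single u) = (u , x∈⁅x⁆ u) , λ p q → path (x∈⁅y⁆⇒x≡y u p) (x∈⁅y⁆⇒x≡y u q)
    where
    path : ∀ {a b} → a ≡ u → b ≡ u → Star (AdjIn ⁅ u ⁆) a b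
    path refl refl = ε
  Built⇒Connected {X} (grow u v u∈ v∈ adj built) = (u , lookup⇒∈ u∈) , λ p q → to p ◅◅ Star-sym (to q)
    where
    smaller = proj₂ (Built⇒Connected built)
    keep : ∀ {w} → w ∈ X → w ≢ v → w ∈ X [ v ]≔ false
    keep w∈ w≢v = lookup⇒∈ (trans (lookup∘update′ w≢v X false) (∈⇒lookup w∈))
    to : ∀ {w} → w ∈ X → Star (AdjIn X) w u
    to {w} w∈ with w Fin.≟ v
    ... | yes refl = (w∈ , lookup⇒∈ u∈ , Adj-sym adj) ◅ ε
    ... | no w≢v = Star.map (λ (p , q , a) → remove⊆ X v p , remove⊆ X v q , a)
                     (smaller (keep w∈ w≢v) (keep (lookup⇒∈ u∈) (λ { refl → Adj-irreflexive adj })))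

  -- Follow the path from `a`: its first vertex outside R is entered by the required edge, and
  -- `AdjIn` places that vertex in S.
  crossing : ∀ {S R a b} → a ∈ R → b ∉ R → Star (AdjIn S) a b →
             ∃[ u ] ∃[ v ] u ∈ R × v ∉ R × v ∈ S × Adj u v
  crossing a∈ b∉ ε = ⊥-elim (b∉ a∈)
  crossing {R = R} a∈ b∉ (_◅_ {j = c} (_ , c∈S , adj) path) with c ∈? R
  ... | yes c∈ = crossing c∈ b∉ path
  ... | no c∉ = _ , c , a∈ , c∉ , c∈S , adj

  -- Growing avoids the search for a vertex whose removal keeps S connected. From a single vertex, R
  -- is enlarged along crossing edges until it equals S; each enlargement is a `grow` step, since
  -- deleting the new vertex gives R back. Termination: R strictly increases inside a finite set.
  Connected⇒Built : ∀ {S} → Connected S → Built S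
  Connected⇒Built {S} ((s , s∈) , paths) = extend ⁅ s ⁆ (⊃-wellFounded ⁅ s ⁆)
      (single s) (x∈⁅x⁆ s) (λ p → subst (_∈ S) (sym (x∈⁅y⁆⇒x≡y s p)) s∈)
    where
    extend : ∀ R → Acc _⊃_ R → Built R → s ∈ R → R ⊆ S → Built S
    extend R (acc rec) built s∈R R⊆S with any? (λ x → (x ∈? S) ×-dec ¬? (x ∈? R))
    ... | no none = subst Built (⊆-antisym R⊆S S⊆R) built
      where
      S⊆R : S ⊆ R
      S⊆R {x} x∈ with x ∈? R
      ... | yes p = p
      ... | no p = ⊥-elim (none (x , x∈ , p))
    ... | yes (x , x∈ , x∉) with crossing s∈R x∉ (paths s∈ x∈)
    ...   | u , v , u∈ , v∉ , v∈S , adj =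
      extend R′ (rec (R⊆R′ , v , lookup⇒∈ (lookup∘update v R true) , v∉))
        (grow u v (∈⇒lookup (R⊆R′ u∈)) (lookup∘update v R true) adj (subst Built (sym R′-v) built))
        (R⊆R′ s∈R) R′⊆S
      where
      R′ = R [ v ]≔ true
      ≢v : ∀ {w} → w ∈ R → w ≢ v
      ≢v w∈ refl = v∉ w∈
      R⊆R′ : R ⊆ R′
      R⊆R′ w∈ = lookup⇒∈ (trans (lookup∘update′ (≢v w∈) R true) (∈⇒lookup w∈))
      R′⊆S : R′ ⊆ S
      R′⊆S {w} w∈ with w Fin.≟ v
      ... | yes refl = v∈S
      ... | no w≢v = R⊆S (lookup⇒∈ (trans (sym (lookup∘update′ w≢v R true)) (∈⇒lookup w∈)))
      lookup-v : lookup R v ≡ false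
      lookup-v with lookup R v in eq
      ... | false = refl
      ... | true = ⊥-elim (v∉ (lookup⇒∈ eq))
      R′-v : R′ [ v ]≔ false ≡ R
      R′-v = trans ([]≔-idempotent R v) (trans (cong (R [ v ]≔_) (sym lookup-v)) ([]≔-lookup R v))

  -- The family is indexed by all of `Fin k`, with conditions only on indices below i, so a smaller
  -- i is served by the same family without reindexing.
  Packs : ℕ → Subset n → Set
  Packs i X = Σ[ S ∈ (Fin k → Subset n) ] (∀ {p q} → toℕ p < i → toℕ q < i → p ≢ q → Empty (S p ∩ S q)) ×
                     (∀ p → toℕ p < i → Connected (S p) × Z p ⊆ S p × S p ⊆ X)

  Suits : Fin k → Subset n → Set
  Suits p S = Connected S × Z p ⊆ S

  Packs-zero : ∀ X → Packs 0 X
  Packs-zero X = (λ _ → full) , (λ ()) , (λ _ ())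

  Packs-mono : ∀ {i j X} → i ≤ j → Packs j X → Packs i X
  Packs-mono i≤j (S , dis , ok) =
    S , (λ p< q< → dis (≤-trans p< i≤j) (≤-trans q< i≤j)) , (λ p p< → ok p (≤-trans p< i≤j))

  Packs-suc : ∀ (p : Fin k) d → Suits p (Sel d) → Packs (toℕ p) (Diff d) → Packs (suc (toℕ p)) (Union d)
  Packs-suc p d (conn , Z⊆) (S , dis , ok) = S′ , dis′ , ok′
    where
    S′ : Fin k → Subset n
    S′ q = if does (q Fin.≟ p) then Sel d else S q
    below : ∀ {q} → q ≢ p → toℕ q < suc (toℕ p) → toℕ q < toℕ p
    below q≢p q< = ≤∧≢⇒< (s≤s⁻¹ q<) (λ eq → q≢p (Fin.toℕ-injective eq))
    apart : ∀ {q u} → q ≢ p → toℕ q < suc (toℕ p) → u ∈ S q → u ∈ Sel d → ⊥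
    apart {q} q≢p q< u∈ u∈′ = Diff∌Sel d (proj₂ (proj₂ (ok q (below q≢p q<))) u∈) u∈′
    dis′ : ∀ {q r} → toℕ q < suc (toℕ p) → toℕ r < suc (toℕ p) → q ≢ r → Empty (S′ q ∩ S′ r)
    dis′ {q} {r} q< r< q≢r (u , u∈) with q Fin.≟ p | r Fin.≟ p | x∈p∩q⁻ (S′ q) (S′ r) u∈
    ... | yes refl | yes refl | _ = q≢r refl
    ... | yes refl | no r≢p | u∈q , u∈r = apart r≢p r< u∈r u∈q
    ... | no q≢p | yes refl | u∈q , u∈r = apart q≢p q< u∈q u∈r
    ... | no q≢p | no r≢p | u∈q , u∈r = dis (below q≢p q<) (below r≢p r<) q≢r (u , x∈p∩q⁺ (u∈q , u∈r))
    ok′ : ∀ q → toℕ q < suc (toℕ p) → Connected (S′ q) × Z q ⊆ S′ q × S′ q ⊆ Union d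
    ok′ q q< with q Fin.≟ p
    ... | yes refl = conn , Z⊆ , Sel⊆Union d
    ... | no q≢p = let c , z , s = ok q (below q≢p q<) in c , z , λ u∈ → Diff⊆Union d (s u∈)

  -- The set `S p` supplies the inner digits; disjointness keeps the earlier sets out of it and
  -- hence inside `Diff d`.
  Packs-suc⁻¹ : ∀ (p : Fin k) {X} → Packs (suc (toℕ p)) X →
                ∃[ d ] Union d ≡ X × Suits p (Sel d) × Packs (toℕ p) (Diff d)
  Packs-suc⁻¹ p {X} (S , dis , ok) with ok p ≤-refl
  ... | conn , Z⊆ , S⊆X with digits X (S p) S⊆X
  ... | d , refl , eq = d , refl , subst (Suits p) (sym eq) (conn , Z⊆) ,
    S , (λ q< r< → dis (m≤n⇒m≤1+n q<) (m≤n⇒m≤1+n r<)) ,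
    λ q q< → let c , z , s = ok q (m≤n⇒m≤1+n q<) in c , z ,
      λ u∈ → ∈Union d (s u∈) (λ u∈′ → dis (m≤n⇒m≤1+n q<) ≤-refl (λ { refl → <-irrefl refl q< })
        (_ , x∈p∩q⁺ (u∈ , subst (_ ∈_) eq u∈′)))

  Packs⇒Yes : Packs k full → YesInstance I
  Packs⇒Yes (S , dis , ok) = S , dis (Fin.toℕ<n _) (Fin.toℕ<n _) ,
    (λ i → proj₁ (ok i (Fin.toℕ<n i))) , (λ i → proj₁ (proj₂ (ok i (Fin.toℕ<n i))))

  Yes⇒Packs : YesInstance I → Packs k full
  Yes⇒Packs (S , dis , conn , Z⊆) = S , (λ _ _ → dis) , λ p _ → conn p , Z⊆ p , ⊆⊤

  pair : Fin n × Fin n → List ℕ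
  pair e = toℕ (proj₁ e) ∷ toℕ (proj₂ e) ∷ []

  edgeCells termCells : List ℕ
  edgeCells = concatMap pair edges
  termCells = concatMap (λ i → List.map bit (Vec.toList (Z i))) (List.allFin k)

  termBase inputSize : ℕ
  termBase  = 3 + m + m
  inputSize = termBase + k * n

  length-edgeCells : length edgeCells ≡ m + m
  length-edgeCells = trans (length-concatMap pair {2} (λ _ → refl) edges)
    (trans (*-comm m 2) (cong (m +_) (+-identityʳ m)))

  length-χ : ∀ (i : Fin k) → length (List.map bit (Vec.toList (Z i))) ≡ n
  length-χ i = trans (length-map bit (Vec.toList (Z i))) (length-toList (Z i))

  length-encode : length (encode I) ≡ inputSize
  length-encode = cong (3 +_) (trans (length-++ edgeCells)
    (cong₂ _+_ length-edgeCells (trans (length-concatMap _ length-χ (List.allFin k)) (cong (_* n) (length-tabulate {n = k} (λ i → i))))))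

  cell-term : ∀ (i : Fin k) {p} → p < n → cell (encode I) (termBase + toℕ i * n + p) ≡ χ (Z i) p
  cell-term i {p} p<n = trans (cong (cell (edgeCells ++ termCells))
      (trans (+-assoc (m + m) _ p) (cong (_+ (toℕ i * n + p)) (sym length-edgeCells))))
    (trans (cell-++ edgeCells termCells _) (cell-concatMap _ length-χ (λ j → j) i p<n))

  edgeˡ edgeʳ : ℕ → ℕ
  edgeˡ j = cell (encode I) (3 + (j + j))
  edgeʳ j = cell (encode I) (4 + (j + j))

  EdgeAt : ℕ → Fin n × Fin n → Set
  EdgeAt j (u , v) = edgeˡ j ≡ toℕ u × edgeʳ j ≡ toℕ v

  private
    at : List (Fin n × Fin n) → ℕ → Fin n × Fin n → Set
    at es j (u , v) = cell (concatMap pair es ++ termCells) (j + j) ≡ toℕ u ×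
                      cell (concatMap pair es ++ termCells) (suc (j + j)) ≡ toℕ v

    at-suc : ∀ {e es} j {e′} → at es j e′ → at (e ∷ es) (suc j) e′
    at-suc j p rewrite +-suc j j = p

  edgeAt : ∀ {j} → j < m → ∃[ e ] e ∈ˡ edges × EdgeAt j e
  edgeAt {j} = go edges j
    where
    go : ∀ es j → j < length es → ∃[ e ] e ∈ˡ es × at es j e
    go (e ∷ es) zero    _       = e , here refl , refl , refl
    go (e ∷ es) (suc j) (s≤s p) = let e′ , q , r = go es j p in e′ , there q , at-suc {e} {es} j r

  findEdge : ∀ {e} → e ∈ˡ edges → ∃[ j ] j < m × EdgeAt j e
  findEdge = go
    where
    go : ∀ {e es} → e ∈ˡ es → ∃[ j ] j < length es × at es j e
    go (here refl) = 0 , s≤s z≤n , refl , refl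
    go (there {x} {es} q) = let j , p , r = go q in suc j , s≤s p , at-suc {x} {es} j r

-- Memory layout, setup, and the program for the table of pairs.

-- Registers: 0 answer, 1 n, 2 m, 3 k, 4 the constant 1, 5 2ⁿ, 6 3ⁿ, 7–13 the
-- bases of the arrays, 14 and above scratch.  The arrays are
--   0, 1  X and S, for the ternary codes of the pairs S ⊆ X,
--   2     whether X is connected,
--   3     the characteristic vector of the current X,
--   4     the weight of each vertex in a mask,
--   5     i if X was last found suitable for Sᵢ,
--   6     the largest i such that S₁, …, Sᵢ fit into X.

readInput sumStep powStep arrayBases : Program
readInput =
  -- Writing to the highest register pads the register list to its final length 24; from then on all
  -- preconditions compute on a list of known shape.
  23 ≔const 0 ⨾ 4 ≔const 1 ⨾ 1 ≔load 0 ⨾ 14 ≔const 1 ⨾ 2 ≔load 14 ⨾ 14 ≔const 2 ⨾ 3 ≔load 14 ⨾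
  15 ≔const 3 ⨾ 15 ≔ 15 ⊕ 2 ⨾ 15 ≔ 15 ⊕ 2 ⨾ 7 ≔copy 15 ⨾ 14 ≔copy 3
-- In place of the product `k * n`, n is added k times; register 7 ends at the first address after
-- the input.
sumStep = 7 ≔ 7 ⊕ 1 ⨾ 14 ≔ 14 ⊖ 4
powStep = 5 ≔ 5 ⊕ 5 ⨾ 16 ≔ 6 ⊕ 6 ⨾ 6 ≔ 6 ⊕ 16 ⨾ 14 ≔ 14 ⊖ 4
arrayBases = 8 ≔ 7 ⊕ 6 ⨾ 9 ≔ 8 ⊕ 6 ⨾ 10 ≔ 9 ⊕ 6 ⨾ 11 ≔ 10 ⊕ 6 ⨾ 12 ≔ 11 ⊕ 6 ⨾ 13 ≔ 12 ⊕ 6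

onePow : Program
onePow = 5 ≔const 1 ⨾ 6 ≔const 1 ⨾ 14 ≔copy 1

setup : Program
setup = readInput ⨾ whileNonzero 14 loop sumStep ⨾ onePow ⨾ whileNonzero 14 loop powStep ⨾ arrayBases

-- Vertices are treated from the last one, which has the least weight. The `3^ v` finished entries
-- stay in place as those with leading digit `outer`, and each is copied to the two blocks for
-- `rest` and `inner`.
tripleStep vertexStart vertexEnd vertexStep pairTable : Program
tripleStep =
  19 ≔ 19 ⊖ 4 ⨾ 20 ≔ 7 ⊕ 19 ⨾ 21 ≔load 20 ⨾ 20 ≔ 8 ⊕ 19 ⨾ 22 ≔load 20 ⨾
  23 ≔ 19 ⊕ 17 ⨾ 21 ≔ 21 ⊕ 18 ⨾ 20 ≔ 7 ⊕ 23 ⨾ store 20 ≔ 21 ⨾ 20 ≔ 8 ⊕ 23 ⨾ store 20 ≔ 22 ⨾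
  23 ≔ 23 ⊕ 17 ⨾ 20 ≔ 7 ⊕ 23 ⨾ store 20 ≔ 21 ⨾ 22 ≔ 22 ⊕ 18 ⨾ 20 ≔ 8 ⊕ 23 ⨾ store 20 ≔ 22
vertexStart =
  14 ≔ 14 ⊖ 4 ⨾ 20 ≔ 11 ⊕ 14 ⨾ store 20 ≔ 18 ⨾ 20 ≔ 9 ⊕ 18 ⨾ store 20 ≔ 4 ⨾ 19 ≔copy 17
vertexEnd = 20 ≔ 17 ⊕ 17 ⨾ 17 ≔ 17 ⊕ 20 ⨾ 18 ≔ 18 ⊕ 18
vertexStep = vertexStart ⨾ whileNonzero 19 loop tripleStep ⨾ vertexEnd
pairTable = (17 ≔const 1 ⨾ 18 ≔const 1 ⨾ 14 ≔copy 1) ⨾ whileNonzero 14 loop vertexStep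

module Layout (I : Instance) (W : ℕ) where
  open Instance I public
  open Logic I public
  open Machine W inputSize (3^ n) (cell (encode I)) public

  N L : ℕ
  N = 2^ n
  L = 3^ n

  -- The seven arrays end at `base 7`; one further length is slack. The summand k covers the round
  -- numbers, which the addresses do not bound when n is 0.
  WordSize : Set
  WordSize = k + base 8 ≤ W

module Setup (I : Instance) (W : ℕ) (big : Layout.WordSize I W) where
  open Layout I W public

  n<L : n < L
  n<L = ≤-trans (v<2^ n) (2^≤3^ n)

  base8≤W : base 8 ≤ W
  base8≤W = ≤-trans (m≤n+m _ k) big

  k≤W : k ≤ W
  k≤W = ≤-trans (m≤m+n k _) big

  address : ∀ a {i} {a≤7 : T (a ≤ᵇ 7)} → i < L → base a + i ≤ W
  address a {i} {a≤7} i<L = begin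
    base a + i    ≤⟨ +-monoʳ-≤ (base a) (<⇒≤ i<L) ⟩
    base (suc a)  ≤⟨ base-mono (≤⇒≤′ (s≤s (≤ᵇ⇒≤ a 7 a≤7))) ⟩
    base 8        ≤⟨ base8≤W ⟩
    W             ∎
    where open ≤-Reasoning

  input≤W : ∀ {p} → p ≤ inputSize → p ≤ W
  input≤W p≤ = ≤-trans p≤ (≤-trans (base-mono {0} {8} (≤⇒≤′ z≤n)) base8≤W)

  double≤W : ∀ {x y} → x ≤ L → y ≤ L → x + y ≤ W
  double≤W {x} {y} x≤ y≤ = begin
    x + y              ≤⟨ +-mono-≤ x≤ y≤ ⟩
    L + L              ≤⟨ +-monoˡ-≤ L (m≤n+m L (base 6)) ⟩
    base 6 + L + L     ≤⟨ base8≤W ⟩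
    W                  ∎
    where open ≤-Reasoning

  small≤W : ∀ {x} → x ≤ L → x ≤ W
  small≤W x≤ = ≤-trans (m≤m+n _ 0) (double≤W x≤ z≤n)

  3≤size : 3 ≤ inputSize
  3≤size = m≤m+n 3 _

  c≤W : ∀ {c} → c ≤ 3 → c ≤ W
  c≤W c≤3 = input≤W (≤-trans c≤3 3≤size)

  termBase≤ : ∀ {i} → i ≤ k → termBase + i * n ≤ inputSize
  termBase≤ i≤k = +-monoʳ-≤ termBase (*-monoˡ-≤ n i≤k)

  -- Sizes and base addresses are parameters because the setup passes through register files in
  -- which they are still 0 or partial; `E` is the final instance.
  env : (N L b₀ b₁ b₂ b₃ b₄ b₅ b₆ : ℕ) → Vec ℕ 10 → List ℕ
  env N L b₀ b₁ b₂ b₃ b₄ b₅ b₆ s =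
    0 ∷ n ∷ m ∷ k ∷ 1 ∷ N ∷ L ∷ b₀ ∷ b₁ ∷ b₂ ∷ b₃ ∷ b₄ ∷ b₅ ∷ b₆ ∷ Vec.toList s

  E : Vec ℕ 10 → List ℕ
  E = env N L (base 0) (base 1) (base 2) (base 3) (base 4) (base 5) (base 6)

  blank : Heap
  blank _ _ = 0

  AfterSetup : Post
  AfterSetup vs h = (Σ[ s ∈ Vec ℕ 8 ] vs ≡ E (0 ∷ termBase ∷ s)) × h ≡ blank

  setupTime : ℕ
  setupTime = 12 + ((1 + k * suc (cost sumStep)) + (3 + ((1 + n * suc (cost powStep)) + 6)))

  setup-runs : Runs setup [] blank setupTime AfterSetup
  setup-runs = seq (block readInput
    ( c≤W z≤n , c≤W (s≤s z≤n) , input (≤-trans (s≤s z≤n) 3≤size) , n , refl , c≤W (s≤s z≤n)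
    , input (≤-trans (s≤s (s≤s z≤n)) 3≤size) , m , refl , c≤W (s≤s (s≤s z≤n)) , input 3≤size , k , refl , c≤W ≤-refl
    , 3 + m , refl , input≤W (≤-trans (m≤m+n (3 + m) m) (m≤m+n termBase _))
    , termBase , refl , input≤W (m≤m+n termBase _) , termBase , refl , k , refl
    , seq (consequence afterSum (for SumInv (cost sumStep) (λ { (_ , refl , _) → refl }) sum k (termBase , refl , refl , refl)))))
    where
    SumInv : ℕ → Post
    SumInv j vs h = ∃[ d ] vs ≡ env 0 0 d 0 0 0 0 0 0 (j ∷ termBase ∷ 0 ∷ 0 ∷ 0 ∷ 0 ∷ 0 ∷ 0 ∷ 0 ∷ 0 ∷ [])
                         × d + j * n ≡ inputSize × h ≡ blank
    sum : ∀ j {vs h} → SumInv (suc j) vs h → cell vs 14 ≢ 0 × Runs sumStep vs h (cost sumStep) (SumInv j)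
    sum j (d , refl , eq , refl) = (λ ()) , block sumStep
      (d + n , refl , input≤W (≤-trans (m≤m+n _ (j * n)) (≤-reflexive eq′)) , j , refl , d + n , refl , eq′ , refl)
      where eq′ = trans (+-assoc d n _) eq
    PowInv : ℕ → Post
    PowInv j vs h = ∃[ v ] (Σ[ s ∈ Vec ℕ 8 ] vs ≡ env (2^ v) (3^ v) inputSize 0 0 0 0 0 0 (j ∷ termBase ∷ s))
                         × v + j ≡ n × h ≡ blank
    pow : ∀ j {vs h} → PowInv (suc j) vs h → cell vs 14 ≢ 0 × Runs powStep vs h (cost powStep) (PowInv j)
    pow j (v , (_ ∷ s , refl) , eq , refl) = (λ ()) , block powStep
      ( 2^ (suc v) , refl , small≤W (≤-trans (2^≤3^ (suc v)) 3^≤L)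
      , 3^ v + 3^ v , refl , small≤W (≤-trans (m≤n+m _ (3^ v)) 3^≤L) , 3^ (suc v) , refl , small≤W 3^≤L , j , refl
      , suc v , (_ , refl) , trans (sym (+-suc v j)) eq , refl)
      where 3^≤L = 3^-mono-≤ {suc v} (≤-trans (m≤m+n (suc v) j) (≤-reflexive (trans (sym (+-suc v j)) eq)))
    afterPow : ∀ {vs h} → PowInv 0 vs h → Runs arrayBases vs h (cost arrayBases) AfterSetup
    afterPow (v , (s , refl) , eq , refl) with trans (sym (+-identityʳ v)) eq
    ... | refl = block arrayBases
      ( base 1 , refl , bd 0 , base 2 , refl , bd 1 , base 3 , refl , bd 2 , base 4 , refl , bd 3
      , base 5 , refl , bd 4 , base 6 , refl , bd 5 , (_ , refl) , refl )
      where
      bd : ∀ a {a≤7 : T (a ≤ᵇ 7)} → base (suc a) ≤ W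
      bd a {a≤7} = ≤-trans (base-mono (≤⇒≤′ (s≤s (≤ᵇ⇒≤ a 7 a≤7)))) base8≤W
    afterSum : ∀ {vs h} → SumInv 0 vs h → Runs (onePow ⨾ whileNonzero 14 loop powStep ⨾ arrayBases) vs h
                 (3 + ((1 + n * suc (cost powStep)) + 6)) AfterSetup
    afterSum (d , refl , eq , refl) with trans (sym (+-identityʳ d)) eq
    ... | refl = seq (block onePow
      ( c≤W (s≤s z≤n) , c≤W (s≤s z≤n) , n , refl
      , seq (consequence afterPow (for PowInv (cost powStep) (λ { (_ , (_ , refl) , _) → refl }) pow n
              (0 , (_ , refl) , refl , refl)))))

update-≢0 : ∀ f a v {b} → v ≢ 0 → f b ≢ 0 → update f a v b ≢ 0
update-≢0 f a v {b} v≢0 f≢0 with b ≟ a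
... | yes refl = λ z → v≢0 (trans (sym (update-same f a v)) z)
... | no b≢a = λ z → f≢0 (trans (sym (update-other f a v b≢a)) z)

-- Correctness and time of the table of pairs.

module PairTable (I : Instance) (W : ℕ) (big : Layout.WordSize I W) where
  open Setup I W big public

  -- The arrays are passed separately, so that facts about some arrays hold
  -- verbatim after writing to the others.
  Entry : (f g : ℕ → ℕ) → ∀ {v} → Vec Digit v → Set
  Entry f g d = f (code d) ≡ val (Union d) × g (code d) ≡ val (Sel d)

  Pairs : ℕ → (f g : ℕ → ℕ) → Set
  Pairs v f g = (d : Vec Digit v) → Entry f g d

  Weights : ℕ → (ℕ → ℕ) → Set
  Weights j f = ∀ q w → q + suc w ≡ n → j ≤ q → f q ≡ 2^ w

  BuiltSound : (ℕ → ℕ) → Set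
  BuiltSound f = ∀ x → f x ≢ 0 → ∃[ Y ] val Y ≡ x × Built Y

  Singletons : ℕ → (ℕ → ℕ) → Set
  Singletons j f = ∀ (u : Fin n) → j ≤ toℕ u → f (val ⁅ u ⁆) ≢ 0

  Zeros : (ℕ → ℕ) → Set
  Zeros f = ∀ i → f i ≡ 0

  BuiltSound-mark : ∀ {f Y} → BuiltSound f → Built Y → BuiltSound (update f (val Y) 1)
  BuiltSound-mark {f} {Y} snd built x nz with x ≟ val Y
  ... | yes refl = Y , refl , built
  ... | no x≢ = snd x (λ z → nz (trans (update-other f (val Y) 1 x≢) z))

  module Tripling (v : ℕ) (v<n : v < n) (h₁ : Heap) (x₁ x₂ x₃ : ℕ) where

    p = 3^ v
    b = 2^ v

    -- The old block is only read: both writes go to indices of at least p. As the frame condition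
    -- speaks of `2 + a` in constructor form, writes to arrays 0 and 1 compute away in it and it
    -- passes through each iteration verbatim.
    Inv : ℕ → Post
    Inv t vs h = (Σ[ s ∈ Vec ℕ 4 ] vs ≡ E (x₁ ∷ x₂ ∷ x₃ ∷ p ∷ b ∷ t ∷ s))
      × t ≤ p × Pairs v (h 0) (h 1)
      × (∀ d → t ≤ code {v} d → Entry (h 0) (h 1) (rest ∷ d) × Entry (h 0) (h 1) (inner ∷ d))
      × (∀ a → h (2 + a) ≡ h₁ (2 + a))

    3p≤L : p + p + p ≤ L
    3p≤L = ≤-trans (≤-reflexive (+-assoc p p p)) (3^-mono-≤ v<n)

    module _ (f : ℕ → ℕ) (t y z : ℕ) (t<p : t < p) where

      twice : ℕ → ℕ
      twice = update (update f (t + p) y) (t + p + p) z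

      p≤t+p : p ≤ t + p
      p≤t+p = m≤n+m p t

      t+p<t+p+p : t + p < t + p + p
      t+p<t+p+p = m<m+n (t + p) (≤-trans (s≤s z≤n) t<p)

      twice-other : ∀ {i} → i ≢ t + p → i ≢ t + p + p → twice i ≡ f i
      twice-other ≢₁ ≢₂ = trans (update-other (update f (t + p) y) _ z ≢₂) (update-other f _ y ≢₁)

      twice-low : ∀ {i} → i < p → twice i ≡ f i
      twice-low i<p = twice-other (<⇒≢ (≤-trans i<p p≤t+p)) (<⇒≢ (≤-trans i<p (≤-trans p≤t+p (m≤m+n _ p))))

      twice-rest : twice (t + p) ≡ y
      twice-rest = trans (update-other (update f (t + p) y) _ z (<⇒≢ t+p<t+p+p)) (update-same f _ y)

      twice-inner : twice (t + p + p) ≡ z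
      twice-inner = update-same (update f (t + p) y) (t + p + p) z

      twice-rest-other : ∀ {i} → i < p → i ≢ t → twice (i + p) ≡ f (i + p)
      twice-rest-other {i} i<p i≢t = twice-other (λ eq → i≢t (+-cancelʳ-≡ p i t eq))
        (<⇒≢ (≤-trans (+-monoˡ-< p i<p) (+-monoˡ-≤ p p≤t+p)))

      twice-inner-other : ∀ {i} → i < p → i ≢ t → twice (i + p + p) ≡ f (i + p + p)
      twice-inner-other {i} i<p i≢t = twice-other
        (λ eq → <⇒≢ (≤-trans (+-monoˡ-< p t<p) (+-monoˡ-≤ p (m≤n+m p i))) (sym eq))
        (λ eq → i≢t (+-cancelʳ-≡ p i t (+-cancelʳ-≡ p (i + p) (t + p) eq)))

    step : ∀ t {vs h} → Inv (suc t) vs h → cell vs 19 ≢ 0 × Runs tripleStep vs h (cost tripleStep) (Inv t)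
    step t {h = h} (((_ ∷ _ ∷ _ ∷ _ ∷ []) , refl) , t<p , old , new , frame) = (λ ()) , block tripleStep
      ( t , refl , base 0 + t , refl , address 0 t<L , array 0 t t<L , X , refl
      , base 1 + t , refl , address 1 t<L , array 1 t t<L , S , refl
      , t + p , refl , small≤W (<⇒≤ t+p<L) , X + b , refl , double≤W (<⇒≤ X<L) b≤L
      , base 0 + (t + p) , refl , address 0 t+p<L , slot 0 (t + p) t+p<L
      , base 1 + (t + p) , refl , address 1 t+p<L , slot 1 (t + p) t+p<L
      , t + p + p , refl , small≤W (<⇒≤ t+2p<L)
      , base 0 + (t + p + p) , refl , address 0 t+2p<L , slot 0 (t + p + p) t+2p<L
      , S + b , refl , double≤W (<⇒≤ S<L) b≤L
      , base 1 + (t + p + p) , refl , address 1 t+2p<L , slot 1 (t + p + p) t+2p<L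
      , (_ , refl) , <⇒≤ t<p
      , (λ d → trans (low₀ (code<3^ d)) (proj₁ (old d)) , trans (low₁ (code<3^ d)) (proj₂ (old d)))
      , new′ , frame )
      where
      X S : ℕ
      X = h 0 t
      S = h 1 t
      t+p<L : t + p < L
      t+p<L = ≤-trans (+-monoˡ-< p t<p) (≤-trans (m≤m+n (p + p) p) 3p≤L)
      t+2p<L : t + p + p < L
      t+2p<L = ≤-trans (+-monoˡ-< p (+-monoˡ-< p t<p)) 3p≤L
      t<L : t < L
      t<L = ≤-trans (s≤s (m≤m+n t p)) t+p<L
      b≤L : b ≤ L
      b≤L = ≤-trans (2^≤3^ v) (3^-mono-≤ (<⇒≤ v<n))
      d₀ = proj₁ (code-surjective v t<p)
      code-d₀ : code d₀ ≡ t
      code-d₀ = proj₂ (code-surjective v t<p)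
      X<L : X < L
      X<L = ≤-trans (subst (_< b) (trans (sym (proj₁ (old d₀))) (cong (h 0) code-d₀)) (val<2^ (Union d₀))) b≤L
      S<L : S < L
      S<L = ≤-trans (subst (_< b) (trans (sym (proj₂ (old d₀))) (cong (h 1) code-d₀)) (val<2^ (Sel d₀))) b≤L
      low₀ = λ {i} → twice-low (h 0) t (X + b) (X + b) t<p {i}
      low₁ = λ {i} → twice-low (h 1) t S (S + b) t<p {i}
      f g : ℕ → ℕ
      f = twice (h 0) t (X + b) (X + b) t<p
      g = twice (h 1) t S (S + b) t<p
      new′ : ∀ d → t ≤ code {v} d → Entry f g (rest ∷ d) × Entry f g (inner ∷ d)
      new′ d t≤ with code d ≟ t
      ... | yes eq = (trans (cong (λ i → f (i + p)) eq) (trans (twice-rest (h 0) t _ _ t<p) (cong (_+ b) X≡))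
                     , trans (cong (λ i → g (i + p)) eq) (trans (twice-rest (h 1) t _ _ t<p) S≡))
                   , (trans (cong (λ i → f (i + p + p)) eq) (trans (twice-inner (h 0) t _ _ t<p) (cong (_+ b) X≡))
                     , trans (cong (λ i → g (i + p + p)) eq) (trans (twice-inner (h 1) t _ _ t<p) (cong (_+ b) S≡)))
        where
        X≡ : X ≡ val (Union d)
        X≡ = trans (cong (h 0) (sym eq)) (proj₁ (old d))
        S≡ : S ≡ val (Sel d)
        S≡ = trans (cong (h 1) (sym eq)) (proj₂ (old d))
      ... | no neq with new d (≤∧≢⇒< t≤ (λ eq → neq (sym eq)))
      ...   | (r₀ , r₁) , (i₀ , i₁) =
          (trans (twice-rest-other (h 0) t _ _ t<p (code<3^ d) neq) r₀ , trans (twice-rest-other (h 1) t _ _ t<p (code<3^ d) neq) r₁)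
        , (trans (twice-inner-other (h 0) t _ _ t<p (code<3^ d) neq) i₀ , trans (twice-inner-other (h 1) t _ _ t<p (code<3^ d) neq) i₁)

    tripled : ∀ {vs h} → Inv 0 vs h → Pairs (suc v) (h 0) (h 1)
    tripled (_ , _ , old , new , _) (outer ∷ d) = old d
    tripled (_ , _ , old , new , _) (rest ∷ d)  = proj₁ (new d z≤n)
    tripled (_ , _ , old , new , _) (inner ∷ d) = proj₂ (new d z≤n)

    tripling-runs : ∀ s → Pairs v (h₁ 0) (h₁ 1) →
      Runs (whileNonzero 19 loop tripleStep) (E (x₁ ∷ x₂ ∷ x₃ ∷ p ∷ b ∷ p ∷ s)) h₁ (1 + p * suc (cost tripleStep)) (Inv 0)
    tripling-runs s pairs = for Inv (cost tripleStep) (λ { ((_ , refl) , _) → refl }) step p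
      ((s , refl) , ≤-refl , pairs , (λ d p≤ → ⊥-elim (<⇒≱ (code<3^ d) p≤)) , λ _ → refl)

  record TableFacts (j : ℕ) (v : ℕ) (f₀ f₁ f₂ f₄ f₅ f₆ : ℕ → ℕ) : Set where
    constructor facts
    field
      pairs      : Pairs v f₀ f₁
      weights    : Weights j f₄
      sound      : BuiltSound f₂
      singletons : Singletons j f₂
      zeros₅     : Zeros f₅
      zeros₆     : Zeros f₆

  VertexInv : ℕ → Post
  VertexInv j vs h = ∃[ v ] v + j ≡ n × (Σ[ s ∈ Vec ℕ 5 ] ∃[ x ] vs ≡ E (j ∷ termBase ∷ x ∷ 3^ v ∷ 2^ v ∷ s))
    × TableFacts j v (h 0) (h 1) (h 2) (h 4) (h 5) (h 6)

  PairTableDone : Post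
  PairTableDone vs h = (Σ[ s ∈ Vec ℕ 8 ] vs ≡ E (0 ∷ termBase ∷ s))
    × TableFacts 0 n (h 0) (h 1) (h 2) (h 4) (h 5) (h 6)

  vertexTime : ℕ → ℕ
  vertexTime v = cost vertexStart + ((1 + 3^ v * suc (cost tripleStep)) + cost vertexEnd)

  vertexStep-runs : ∀ j v {vs h} → v + suc j ≡ n → (s : Vec ℕ 5) → ∀ x → vs ≡ E (suc j ∷ termBase ∷ x ∷ 3^ v ∷ 2^ v ∷ s) →
    TableFacts (suc j) v (h 0) (h 1) (h 2) (h 4) (h 5) (h 6) → Runs vertexStep vs h (vertexTime v) (VertexInv j)
  vertexStep-runs j v {h = h} eq (_ ∷ _ ∷ _ ∷ _ ∷ _ ∷ []) x refl (facts pairs weights sound singletons z₅ z₆) =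
    seq (block vertexStart
      ( j , refl , base 4 + j , refl , address 4 j<L , slot 4 j j<L
      , base 2 + 2^ v , refl , address 2 b<L , slot 2 (2^ v) b<L , 3^ v , refl
      , seq (consequence after (tripling-runs _ pairs))))
    where
    h₁ = write (write h 4 j (2^ v)) 2 (2^ v) 1
    v<n : v < n
    v<n = ≤-trans (≤-trans (s≤s (m≤m+n v j)) (≤-reflexive (sym (+-suc v j)))) (≤-reflexive eq)
    j<n : j < n
    j<n = ≤-trans (m≤n+m (suc j) v) (≤-reflexive eq)
    j<L = <-trans j<n n<L
    b<L : 2^ v < L
    b<L = ≤-trans (2^-mono-< v<n) (2^≤3^ n)
    open Tripling v v<n h₁ j termBase x
    u : Fin n
    u = Fin.fromℕ< j<n
    u≡j : toℕ u ≡ j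
    u≡j = Fin.toℕ-fromℕ< j<n
    w≡v : Weight.weight (weigh u) ≡ v
    w≡v = suc-injective (+-cancelˡ-≡ j _ _ (trans (cong (_+ suc (Weight.weight (weigh u))) (sym u≡j))
            (trans (Weight.position (weigh u)) (trans (sym eq) (trans (+-suc v j) (trans (cong suc (+-comm v j)) (sym (+-suc j v))))))))
    val-u : val ⁅ u ⁆ ≡ 2^ v
    val-u = trans (Weight.singleton (weigh u)) (cong 2^ w≡v)
    weights′ : Weights j (update (h 4) j (2^ v))
    weights′ q w qw j≤q with q ≟ j
    ... | no q≢j = trans (update-other (h 4) j _ q≢j) (weights q w qw (≤∧≢⇒< j≤q (λ e → q≢j (sym e))))
    ... | yes refl = trans (update-same (h 4) j _) (cong 2^ (suc-injective (+-cancelˡ-≡ j _ _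
            (trans (trans (+-suc j v) (trans (cong suc (+-comm j v)) (sym (+-suc v j)))) (trans eq (sym qw))))))
    sound′ : BuiltSound (update (h 2) (2^ v) 1)
    sound′ = subst (λ y → BuiltSound (update (h 2) y 1)) val-u (BuiltSound-mark sound (single u))
    singletons′ : Singletons j (update (h 2) (2^ v) 1)
    singletons′ u′ j≤ with toℕ u′ ≟ j
    ... | no ≢j = update-≢0 (h 2) (2^ v) 1 (λ ()) (singletons u′ (≤∧≢⇒< j≤ (λ e → ≢j (sym e))))
    ... | yes ≡j with Fin.toℕ-injective (trans ≡j (sym u≡j))
    ...   | refl = λ z → 1≢0 (trans (sym (trans (cong (update (h 2) (2^ v) 1) val-u) (update-same (h 2) (2^ v) 1))) z)
      where
      1≢0 : 1 ≢ 0
      1≢0 ()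
    after : ∀ {vs h′} → Inv 0 vs h′ → Runs vertexEnd vs h′ (cost vertexEnd) (VertexInv j)
    after {h′ = h′} inv@((_ ∷ _ ∷ _ ∷ _ ∷ [] , refl) , _ , _ , _ , frame) = block vertexEnd
      ( p + p , refl , small≤W (≤-trans (m≤m+n (p + p) p) 3p≤L) , 3^ (suc v) , refl , small≤W (3^-mono-≤ v<n)
      , 2^ (suc v) , refl , small≤W (≤-trans (2^≤3^ (suc v)) (3^-mono-≤ v<n))
      , suc v , trans (sym (+-suc v j)) eq , (_ , x , refl)
      , facts (tripled {h = h′} inv) (subst (Weights j) (sym (frame 2)) weights′) (subst BuiltSound (sym (frame 0)) sound′)
          (subst (Singletons j) (sym (frame 0)) singletons′) (subst Zeros (sym (frame 3)) z₅) (subst Zeros (sym (frame 4)) z₆) )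

  -- Adding a vertex to the table of 3ᵛ pairs costs O(3ᵛ⁺¹ − 3ᵛ), so the total telescopes.
  pairTableTime : ℕ → ℕ
  pairTableTime j = 1 + 15 * (L ∸ 3^ (n ∸ j))

  vertexTime-step : ∀ v j → v + suc j ≡ n → suc (vertexTime v + pairTableTime j) ≤ pairTableTime (suc j)
  vertexTime-step v j eq = begin
    suc (vertexTime v + (1 + 15 * (L ∸ 3^ (n ∸ j))))  ≡⟨ cong (λ z → suc (vertexTime v + (1 + 15 * (L ∸ 3^ z)))) n∸j ⟩
    suc (vertexTime v + (1 + 15 * A))                 ≡⟨ expand A p ⟩
    -- Rounding 11 up to `12 * p` gives `30 * p`, which is 15 for each of the `2 * p` new entries:
    -- the origin of the constant 15.
    1 + (11 + 18 * p + 15 * A)                        ≤⟨ s≤s (+-monoˡ-≤ (15 * A) (+-monoˡ-≤ (18 * p) 11≤12p)) ⟩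
    1 + (12 * p + 18 * p + 15 * A)                    ≡⟨ collect A p ⟩
    1 + 15 * (A + (p + p))                            ≡⟨ cong (λ z → 1 + 15 * z) A+2p ⟩
    1 + 15 * (L ∸ p)                                  ≡⟨ cong (λ z → 1 + 15 * (L ∸ 3^ z)) n∸sj ⟨
    1 + 15 * (L ∸ 3^ (n ∸ suc j))                     ∎
    where
    open ≤-Reasoning
    p = 3^ v
    A = L ∸ 3^ (suc v)
    n∸sj : n ∸ suc j ≡ v
    n∸sj = trans (cong (_∸ suc j) (sym eq)) (m+n∸n≡m v (suc j))
    n∸j : n ∸ j ≡ suc v
    n∸j = trans (cong (_∸ j) (trans (sym eq) (+-suc v j))) (m+n∸n≡m (suc v) j)
    3p≤L : 3^ (suc v) ≤ L
    3p≤L = 3^-mono-≤ (≤-trans (m≤m+n (suc v) j) (≤-reflexive (trans (sym (+-suc v j)) eq)))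
    11≤12p : 11 ≤ 12 * p
    11≤12p = ≤-trans (n≤1+n 11) (*-monoʳ-≤ 12 (≤-trans (1≤2^ v) (2^≤3^ v)))
    A+2p : A + (p + p) ≡ L ∸ p
    A+2p = trans (cong (_+ (p + p)) (sym (∸-+-assoc L p (p + p))))
             (m∸n+n≡m (m+n≤o⇒m≤o∸n (p + p) (≤-trans (≤-reflexive (+-comm (p + p) p)) 3p≤L)))
    expand : ∀ A p → suc (6 + ((1 + p * 18) + 3) + (1 + 15 * A)) ≡ 1 + (11 + 18 * p + 15 * A)
    expand = solve-∀
    collect : ∀ A p → 1 + (12 * p + 18 * p + 15 * A) ≡ 1 + 15 * (A + (p + p))
    collect = solve-∀

  pairTable-runs : ∀ {vs h} → AfterSetup vs h → Runs pairTable vs h (3 + pairTableTime n) PairTableDone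
  pairTable-runs ((_ ∷ _ ∷ _ ∷ s , refl) , refl) = seq (block _
    ( c≤W (s≤s z≤n) , c≤W (s≤s z≤n) , n , refl
    , consequence (λ {vs} {h} → done {vs} {h}) (while VertexInv pairTableTime (s≤s z≤n) (λ { (_ , _ , (_ , _ , refl) , _) → refl }) step n
        -- With no vertex treated the only pair consists of two empty sets, and blank memory already
        -- holds it.
        (0 , refl , (_ , _ , refl) , facts (λ { [] → refl , refl }) (λ q w eq n≤q → ⊥-elim (<⇒≱ (q<n q w eq) n≤q))
          (λ x z → ⊥-elim (z refl)) (λ u n≤u → ⊥-elim (<⇒≱ (Fin.toℕ<n u) n≤u)) (λ _ → refl) (λ _ → refl)))))
    where
    q<n : ∀ q w → q + suc w ≡ n → q < n
    q<n q w eq = ≤-trans (m<m+n q (s≤s z≤n)) (≤-reflexive eq)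
    step : ∀ j {vs h} → VertexInv (suc j) vs h → cell vs 14 ≢ 0 ×
           (Σ[ t ∈ ℕ ] suc (t + pairTableTime j) ≤ pairTableTime (suc j) × Runs vertexStep vs h t (VertexInv j))
    step j (v , eq , (s , x , refl) , fs) =
      (λ ()) , vertexTime v , vertexTime-step v j eq , vertexStep-runs j v eq s x refl fs
    done : ∀ {vs h} → VertexInv 0 vs h → PairTableDone vs h
    done (v , eq , (s , x , refl) , fs) with trans (sym (+-identityʳ v)) eq
    ... | refl = (_ , refl) , fs

-- The table of connected sets.

decodeStep decodeStart edgeStep setStep connTable : Program
decodeStep =
  18 ≔ 18 ⊖ 4 ⨾ 21 ≔ 11 ⊕ 20 ⨾ 22 ≔load 21 ⨾ 21 ≔ 10 ⊕ 20 ⨾ 23 ≔ 22 ⊖ 19 ⨾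
  (ifNonzero 23 then (23 ≔const 0 ⨾ store 21 ≔ 23) else (19 ≔ 19 ⊖ 22 ⨾ store 21 ≔ 4)) ⨾
  20 ≔ 20 ⊕ 4
decodeStart = 14 ≔ 14 ⊖ 4 ⨾ 19 ≔copy 17 ⨾ 20 ≔const 0 ⨾ 18 ≔copy 1

-- The vertex to be removed may be either endpoint, while the input lists an edge in one orientation
-- only; hence the edge loop uses this for both endpoints.
try : Reg → Program
try r =
  22 ≔ 11 ⊕ r ⨾ 22 ≔load 22 ⨾ 22 ≔ 17 ⊖ 22 ⨾ 22 ≔ 9 ⊕ 22 ⨾ 22 ≔load 22 ⨾
  (ifNonzero 22 then (22 ≔ 9 ⊕ 17 ⨾ store 22 ≔ 4) else skip)
edgeStep =
  18 ≔ 18 ⊖ 4 ⨾ 19 ≔ 18 ⊕ 18 ⨾ 20 ≔const 3 ⨾ 19 ≔ 20 ⊕ 19 ⨾ 20 ≔load 19 ⨾ 19 ≔ 4 ⊕ 19 ⨾ 21 ≔load 19 ⨾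
  22 ≔ 10 ⊕ 20 ⨾ 22 ≔load 22 ⨾
  ifNonzero 22
    then (22 ≔ 10 ⊕ 21 ⨾ 22 ≔load 22 ⨾ (ifNonzero 22 then (try 20 ⨾ try 21) else skip))
    else skip
setStep =
  decodeStart ⨾ whileNonzero 18 loop decodeStep ⨾ 18 ≔copy 2 ⨾ whileNonzero 18 loop edgeStep ⨾ 17 ≔ 17 ⊕ 4
connTable = (17 ≔const 0 ⨾ 14 ≔copy 5) ⨾ whileNonzero 14 loop setStep

module ConnTable (I : Instance) (W : ℕ) (big : Layout.WordSize I W) where
  open PairTable I W big public

  BuiltBelow : ℕ → (ℕ → ℕ) → Set
  BuiltBelow x f = ∀ Y → val Y < x → Built Y → f (val Y) ≢ 0

  record ConnFacts (x : ℕ) (f₀ f₁ f₂ f₄ f₅ f₆ : ℕ → ℕ) : Set where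
    constructor connFacts
    field
      table    : TableFacts 0 n f₀ f₁ f₂ f₄ f₅ f₆
      complete : BuiltBelow x f₂

  Facts : ℕ → Heap → Set
  Facts x h = ConnFacts x (h 0) (h 1) (h 2) (h 4) (h 5) (h 6)

  q<q+s : ∀ {q j l} → q + suc j ≡ l → q < l
  q<q+s {q} eq = ≤-trans (m<m+n q (s≤s z≤n)) (≤-reflexive eq)

  module _ (X : Subset n) (x₁ x₂ x₃ : ℕ) where

    x = val X

    x<L : x < L
    x<L = ≤-trans (val<2^ X) (2^≤3^ n)

    Bits : (ℕ → ℕ) → Set
    Bits f = ∀ p → p < n → f p ≡ χ X p

    -- `s` is the part of X still to be decoded, and its value is the remainder held in a register.
    -- It is tied to X by its cells and not by a vector equation, which avoids transport along
    -- `q + j ≡ n`.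
    DecodeInv : ℕ → Post
    DecodeInv j vs h = ∃[ q ] q + j ≡ n × (Σ[ s ∈ Subset j ]
      (Σ[ y ∈ Vec ℕ 3 ] vs ≡ E (x₁ ∷ x₂ ∷ x₃ ∷ x ∷ j ∷ val s ∷ q ∷ y))
      × (∀ p → χ s p ≡ χ X (q + p)) × (∀ p → p < q → h 3 p ≡ χ X p) × Facts x h)

    decode : ∀ j {vs h} → DecodeInv (suc j) vs h →
             cell vs 18 ≢ 0 × Runs decodeStep vs h (cost decodeStep) (DecodeInv j)
    decode j {h = h} (q , eq , b ∷ s , (_ ∷ _ ∷ _ ∷ [] , refl) , tail , done , fs) = (λ ()) , block decodeStep
      ( j , refl , base 4 + q , refl , address 4 q<L , array 4 q q<L , h 4 q , refl
      , base 3 + q , refl , address 3 q<L , h 4 q ∸ val (b ∷ s) , refl , larger b refl , smaller b refl )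
      where
      q<n : q < n
      q<n = q<q+s eq
      q<L = <-trans q<n n<L
      h4q : h 4 q ≡ 2^ j
      h4q = TableFacts.weights (ConnFacts.table fs) q j eq z≤n
      eq′ : suc q + j ≡ n
      eq′ = trans (sym (+-suc q j)) eq
      tail′ : ∀ p → χ s p ≡ χ X (suc q + p)
      tail′ p = trans (tail (suc p)) (cong (χ X) (+-suc q p))
      head : bit b ≡ χ X q
      head = trans (tail 0) (cong (χ X) (+-identityʳ q))
      q+1 : q + 1 ≡ suc q
      q+1 = +-comm q 1
      q+1≤W : q + 1 ≤ W
      q+1≤W = small≤W (subst (_≤ L) (sym q+1) q<L)
      done′ : ∀ {v} → v ≡ χ X q → ∀ p → p < q + 1 → update (h 3) q v p ≡ χ X p
      done′ {v} v≡ p p< with p ≟ q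
      ... | yes refl = trans (update-same (h 3) q v) v≡
      ... | no p≢q = trans (update-other (h 3) q v p≢q) (done p (≤∧≢⇒< (s≤s⁻¹ (subst (p <_) q+1 p<)) p≢q))
      -- A leading 1 makes the remainder at least `2^ j` and a leading 0 keeps it below, so
      -- truncated subtraction of the remainder from the weight is nonzero exactly for bit 0.
      larger : ∀ b′ → b′ ≡ b → h 4 q ∸ val (b ∷ s) ≢ 0 →
        0 ≤ W × (Σ[ l ∈ Slot (base 3 + q) ] ∃[ q′ ] q′ ≡ q + 1 × q′ ≤ W × DecodeInv j (E (x₁ ∷ x₂ ∷ x₃ ∷ x ∷ j ∷ val (b ∷ s) ∷ q′ ∷ base 3 + q ∷ h 4 q ∷ 0 ∷ [])) (writeAt h l 0))
      larger true refl nz = ⊥-elim (nz (m≤n⇒m∸n≡0 (≤-trans (≤-reflexive h4q) (m≤n+m (2^ j) (val s)))))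
      larger false refl nz = z≤n , slot 3 q q<L , q + 1 , refl , q+1≤W , q + 1 , trans (cong (_+ j) q+1) eq′ , s , (_ , refl)
        , (λ p → trans (tail′ p) (cong (λ z → χ X (z + p)) (sym q+1))) , done′ head , fs
      smaller : ∀ b′ → b′ ≡ b → h 4 q ∸ val (b ∷ s) ≡ 0 →
        ∃[ r ] r ≡ val (b ∷ s) ∸ h 4 q × (Σ[ l ∈ Slot (base 3 + q) ] ∃[ q′ ] q′ ≡ q + 1 × q′ ≤ W ×
          DecodeInv j (E (x₁ ∷ x₂ ∷ x₃ ∷ x ∷ j ∷ r ∷ q′ ∷ base 3 + q ∷ h 4 q ∷ h 4 q ∸ val (b ∷ s) ∷ [])) (writeAt h l 1))
      smaller false refl z = ⊥-elim (<⇒≱ (val<2^ s) (≤-trans (≤-reflexive (sym h4q)) (m∸n≡0⇒m≤n z)))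
      smaller true refl z = val s , sym (trans (cong (val s + 2^ j ∸_) h4q) (m+n∸n≡m (val s) (2^ j)))
        , slot 3 q q<L , q + 1 , refl , q+1≤W , q + 1 , trans (cong (_+ j) q+1) eq′ , s
        , (_ , refl)
        , (λ p → trans (tail′ p) (cong (λ z → χ X (z + p)) (sym q+1))) , done′ head , fs

    EdgesDone : ℕ → (ℕ → ℕ) → Set
    EdgesDone e f = ∀ e′ → e ≤ e′ → e′ < m → ∀ u v → EdgeAt e′ (u , v) →
      lookup X u ≡ true → lookup X v ≡ true → Built (X [ u ]≔ false) ⊎ Built (X [ v ]≔ false) → f x ≢ 0

    EdgeFacts : ℕ → Heap → Set
    EdgeFacts e h = Facts x h × Bits (h 3) × EdgesDone e (h 2)

    EdgeInv : ℕ → Post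
    EdgeInv e vs h = (Σ[ s ∈ Vec ℕ 5 ] vs ≡ E (x₁ ∷ x₂ ∷ x₃ ∷ x ∷ e ∷ s)) × e ≤ m × EdgeFacts e h

    mark : ∀ {e h} → EdgeFacts e h → Built X → EdgeFacts e (write h 2 x 1)
    mark {h = h} (connFacts (facts pr ws snd sing z₅ z₆) compl , bits , done) built =
        connFacts (facts pr ws (BuiltSound-mark snd built) (λ u u≥ → mono (sing u u≥)) z₅ z₆)
                  (λ Y Y< bY → mono (compl Y Y< bY))
      , bits , λ e′ e≤ e< u v at u∈ v∈ bs → mono (done e′ e≤ e< u v at u∈ v∈ bs)
      where
      mono : ∀ {y} → h 2 y ≢ 0 → update (h 2) x 1 y ≢ 0
      mono = update-≢0 (h 2) x 1 (λ ())

    marked : ∀ f → update f x 1 x ≢ 0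
    marked f z with () ← trans (sym (update-same f x 1)) z

    remove-index : ∀ {h} → Facts x h → ∀ {a u} → a ≡ toℕ u → lookup X u ≡ true →
                   x ∸ h 4 a ≡ val (X [ u ]≔ false) × val (X [ u ]≔ false) < x
    remove-index {h} fs {u = u} refl u∈ =
        trans (cong (x ∸_) h4) (trans (cong (_∸ 2^ weight) (remove X u∈)) (m+n∸n≡m _ (2^ weight)))
      , subst (val (X [ u ]≔ false) <_) (sym (remove X u∈)) (m<m+n _ (1≤2^ weight))
      where
      open Weight (weigh u)
      h4 : h 4 (toℕ u) ≡ 2^ weight
      h4 = TableFacts.weights (ConnFacts.table fs) (toℕ u) weight position z≤n

    x∸<L : ∀ y → x ∸ y < L
    x∸<L y = ≤-trans (s≤s (m∸n≤m x y)) x<L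

    toℕ<L : ∀ {a} {u : Fin n} → a ≡ toℕ u → a < L
    toℕ<L {u = u} refl = <-trans (Fin.toℕ<n u) n<L

    scratch : ℕ → (a₁ a₂ a₃ a₄ a₅ : ℕ) → List ℕ
    scratch y a₁ a₂ a₃ a₄ a₅ = E (x₁ ∷ x₂ ∷ x₃ ∷ x ∷ a₁ ∷ a₂ ∷ a₃ ∷ a₄ ∷ y ∷ a₅ ∷ [])

    -- In continuation form, so that the calls for the two endpoints chain. If the smaller set is
    -- marked, soundness of the table justifies `grow`; if it is not, completeness below x shows
    -- that it is not `Built`. A mark on X made by the first call survives the second.
    wp-try : ∀ r (Q : Post) {e h y} a₁ a₂ a₃ a₄ a₅ {u v} → EdgeFacts e h →
      lookup X u ≡ true → lookup X v ≡ true → Adj v u → cell (scratch y a₁ a₂ a₃ a₄ a₅) r ≡ toℕ u →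
      (∀ y h′ → EdgeFacts e h′ → (h 2 x ≢ 0 → h′ 2 x ≢ 0) → (Built (X [ u ]≔ false) → h′ 2 x ≢ 0) →
         Q (scratch y a₁ a₂ a₃ a₄ a₅) h′) →
      wp (try r) Q (scratch y a₁ a₂ a₃ a₄ a₅) h
    wp-try r Q {h = h} {y} a₁ a₂ a₃ a₄ a₅ {u} {v} ef@(fs , _) u∈ v∈ adj a≡u cont =
        base 4 + a , refl , address 4 a<L , array 4 a a<L , h 4 a , refl , x ∸ h 4 a , refl
      , base 2 + (x ∸ h 4 a) , refl , address 2 (x∸<L (h 4 a)) , array 2 (x ∸ h 4 a) (x∸<L (h 4 a)) , h 2 (x ∸ h 4 a) , refl
      , (λ nz → base 2 + x , refl , address 2 x<L , slot 2 x x<L ,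
           (let Y , vY , bY = TableFacts.sound (ConnFacts.table fs) _ nz in
            cont _ _ (mark {h = h} ef (grow v u v∈ u∈ adj (subst Built (val-injective Y _ (trans vY (proj₁ ix))) bY)))
              (λ _ → marked (h 2)) (λ _ → marked (h 2))))
      , (λ z → cont _ h ef (λ p → p)
           (λ b _ → ConnFacts.complete fs _ (proj₂ ix) b (trans (cong (h 2) (sym (proj₁ ix))) z)))
      where
      a = cell (scratch y a₁ a₂ a₃ a₄ a₅) r
      a<L : a < L
      a<L = toℕ<L a≡u
      ix = remove-index {h} fs a≡u u∈

    edge : ∀ e {vs h} → EdgeInv (suc e) vs h → cell vs 18 ≢ 0 × Runs edgeStep vs h (cost edgeStep) (EdgeInv e)
    edge e {h = h} ((_ ∷ _ ∷ _ ∷ _ ∷ w ∷ [] , refl) , e<m , ef@(fs , bits , done)) with edgeAt e<m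
    ... | (u , v) , uv∈ , at@(u≡ , v≡) = (λ ()) , block edgeStep
      ( e , refl , e + e , refl , input≤W (≤-trans (m≤n+m (e + e) 3) (<⇒≤ e<D)) , c≤W ≤-refl
      , 3 + (e + e) , refl , input≤W (<⇒≤ e<D) , input e<D , edgeˡ e , refl
      , 4 + (e + e) , refl , input≤W (<⇒≤ e<D′) , input e<D′ , edgeʳ e , refl
      , base 3 + edgeˡ e , refl , address 3 (toℕ<L u≡) , array 3 (edgeˡ e) (toℕ<L u≡) , h 3 (edgeˡ e) , refl
      , (λ nzᵘ → base 3 + edgeʳ e , refl , address 3 (toℕ<L v≡) , array 3 (edgeʳ e) (toℕ<L v≡) , h 3 (edgeʳ e) , refl
          , (λ nzᵛ → let u∈ = member u≡ nzᵘ ; v∈ = member v≡ nzᵛ in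
              wp-try 20 (wp (try 21) (EdgeInv e)) {suc e} {h} {h 3 (edgeʳ e)} e (4 + (e + e)) (edgeˡ e) (edgeʳ e) w {u} {v} ef u∈ v∈ (inj₂ uv∈) u≡ λ y₁ h₁ ef₁ _ builtᵘ →
              wp-try 21 (EdgeInv e) {suc e} {h₁} {y₁} e (4 + (e + e)) (edgeˡ e) (edgeʳ e) w {v} {u} ef₁ v∈ u∈ (inj₁ uv∈) v≡ λ _ h₂ ef₂ mono builtᵛ →
              finish h₂ refl ef₂ (λ { _ _ (inj₁ b) → mono (builtᵘ b) ; _ _ (inj₂ b) → builtᵛ b }))
          , (λ z → finish h refl ef (λ _ v∈ _ → ⊥-elim (lookup⇒χ X v v∈ (trans (sym (bit-at v≡)) z)))))
      , (λ z → finish h refl ef (λ u∈ _ _ → ⊥-elim (lookup⇒χ X u u∈ (trans (sym (bit-at u≡)) z)))))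
      where
      e<D′ : 4 + (e + e) < inputSize
      e<D′ = begin-strict
        4 + (e + e)    <⟨ s≤s (s≤s (s≤s (s≤s (+-monoʳ-< e (n<1+n e))))) ⟩
        3 + (suc e + suc e) ≤⟨ +-monoʳ-≤ 3 (+-mono-≤ e<m e<m) ⟩
        3 + (m + m)    ≤⟨ m≤m+n _ _ ⟩
        inputSize      ∎
        where open ≤-Reasoning
      e<D : 3 + (e + e) < inputSize
      e<D = <-trans (n<1+n _) e<D′
      bit-at : ∀ {a} {w : Fin n} → a ≡ toℕ w → h 3 a ≡ χ X (toℕ w)
      bit-at {w = w} refl = bits _ (Fin.toℕ<n w)
      member : ∀ {a} {w : Fin n} → a ≡ toℕ w → h 3 a ≢ 0 → lookup X w ≡ true
      member {w = w} a≡ nz = χ⇒lookup X w (λ z → nz (trans (bit-at a≡) z))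
      finish : ∀ h′ {vs} {s : Vec ℕ 5} → vs ≡ E (x₁ ∷ x₂ ∷ x₃ ∷ x ∷ e ∷ s) → EdgeFacts (suc e) h′ →
        (lookup X u ≡ true → lookup X v ≡ true → Built (X [ u ]≔ false) ⊎ Built (X [ v ]≔ false) → h′ 2 x ≢ 0) →
        EdgeInv e vs h′
      finish h′ vs≡ (fs′ , bits′ , done′) new = (_ , vs≡) , <⇒≤ e<m , fs′ , bits′ , done″
        where
        done″ : EdgesDone e (h′ 2)
        done″ e′ e≤ e′< u′ v′ (u′≡ , v′≡) with e′ ≟ e
        ... | no e′≢e = done′ e′ (≤∧≢⇒< e≤ (λ eq → e′≢e (sym eq))) e′< u′ v′ (u′≡ , v′≡)
        ... | yes refl with Fin.toℕ-injective (trans (sym u′≡) u≡) | Fin.toℕ-injective (trans (sym v′≡) v≡)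
        ...   | refl | refl = new

    -- Inspect the last step that builds X: the orientation in which its edge is listed decides
    -- which endpoint plays the removed vertex in `EdgesDone`.
    complete-x : ∀ {h} → EdgeFacts 0 h → BuiltBelow (suc x) (h 2)
    complete-x {h} (connFacts table compl , _ , done) Y Y≤x bY with val Y ≟ x
    ... | no Y≢x = compl Y (≤∧≢⇒< (s≤s⁻¹ Y≤x) Y≢x) bY
    ... | yes Y≡x with val-injective Y X Y≡x
    ...   | refl = byBuild bY
      where
      byBuild : Built X → h 2 x ≢ 0
      byBuild (grow u v u∈ v∈ (inj₁ uv) b) = let e , e< , at = findEdge uv in done e z≤n e< u v at u∈ v∈ (inj₂ b)
      byBuild (grow u v u∈ v∈ (inj₂ vu) b) = let e , e< , at = findEdge vu in done e z≤n e< v u at v∈ u∈ (inj₁ b)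
      -- No edge produces singletons; they were marked while the table of pairs was built.
      byBuild (single u) = TableFacts.singletons table u z≤n

  setTime : ℕ
  setTime = 4 + ((1 + n * suc (cost decodeStep)) + (1 + ((1 + m * suc (cost edgeStep)) + 1)))

  SetInv : ℕ → Post
  SetInv j vs h = ∃[ x ] x + j ≡ N × (Σ[ s ∈ Vec ℕ 6 ] ∃[ y ] vs ≡ E (j ∷ termBase ∷ y ∷ x ∷ s)) × Facts x h

  setStep-runs : ∀ j {vs h} → SetInv (suc j) vs h → cell vs 14 ≢ 0 × Runs setStep vs h setTime (SetInv j)
  setStep-runs j (x , eq , (_ ∷ _ ∷ _ ∷ s , y , refl) , fs) with val-surjective n (q<q+s eq)
  ... | X , refl = (λ ()) , seq (block decodeStart (j , refl , val X , refl , c≤W z≤n , n , refl ,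
      seq (consequence afterDecode (for (DecodeInv X j termBase y) (cost decodeStep) (λ { (_ , _ , _ , (_ , refl) , _) → refl })
        (decode X j termBase y) n (0 , refl , X , (_ , refl) , (λ _ → refl) , (λ _ ()) , fs)))))
    where
    x+1 : val X + 1 ≡ suc (val X)
    x+1 = +-comm (val X) 1
    afterEdges : ∀ {vs h} → EdgeInv X j termBase y 0 vs h → Runs (17 ≔ 17 ⊕ 4) vs h 1 (SetInv j)
    afterEdges {h = h} ((_ ∷ _ ∷ _ ∷ _ ∷ _ ∷ [] , refl) , _ , ef@(connFacts table _ , _)) = block (17 ≔ 17 ⊕ 4)
      ( val X + 1 , refl , small≤W (subst (_≤ L) (sym x+1) (x<L X j termBase y))
      , val X + 1 , trans (cong (_+ j) x+1) (trans (sym (+-suc (val X) j)) eq) , (_ , _ , refl)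
      , connFacts table (subst (λ z → BuiltBelow z (h 2)) (sym x+1) (complete-x X j termBase y {h} ef)) )
    afterDecode : ∀ {vs h} → DecodeInv X j termBase y 0 vs h →
      Runs (18 ≔copy 2 ⨾ whileNonzero 18 loop edgeStep ⨾ 17 ≔ 17 ⊕ 4) vs h (1 + ((1 + m * suc (cost edgeStep)) + 1)) (SetInv j)
    afterDecode (q , eq , [] , (_ ∷ _ ∷ _ ∷ [] , refl) , _ , done , fs) with trans (sym (+-identityʳ q)) eq
    ... | refl = seq (block (18 ≔copy 2) (m , refl , seq (consequence afterEdges
      (for (EdgeInv X j termBase y) (cost edgeStep) (λ { ((_ , refl) , _) → refl }) (edge X j termBase y) m
        ((_ , refl) , ≤-refl , fs , done , λ e′ m≤ e′< → ⊥-elim (<⇒≱ e′< m≤))))))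

  ConnTableDone : Post
  ConnTableDone vs h = (Σ[ s ∈ Vec ℕ 8 ] vs ≡ E (0 ∷ termBase ∷ s)) × Facts N h

  connTable-runs : ∀ {vs h} → PairTableDone vs h → Runs connTable vs h (2 + (1 + N * suc setTime)) ConnTableDone
  connTable-runs ((_ ∷ _ ∷ s , refl) , fs) = seq (block _ (c≤W z≤n , N , refl ,
    consequence (λ {vs} {h} → done {vs} {h}) (for SetInv setTime (λ { (_ , _ , (_ , _ , refl) , _) → refl }) setStep-runs N
      (0 , refl , (_ , _ , refl) , connFacts fs (λ _ ())))))
    where
    done : ∀ {vs h} → SetInv 0 vs h → ConnTableDone vs h
    done (x , eq , (s , y , refl) , fs) with trans (sym (+-identityʳ x)) eq
    ... | refl = (_ , refl) , fs

-- The rounds over the terminal sets.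

maskStep suitStep packStep roundStart stamp roundStep rounds answer : Program
-- Register 15 is never reset: the characteristic vectors are adjacent in the input, so each round
-- starts reading where the previous one stopped.
maskStep = 18 ≔ 18 ⊖ 4 ⨾ 19 ≔load 15 ⨾ 17 ≔ 17 ⊕ 17 ⨾ 17 ≔ 17 ⊕ 19 ⨾ 15 ≔ 15 ⊕ 4
suitStep =
  -- Truncated subtraction in both directions tests equality of S with the terminal set.
  18 ≔ 18 ⊖ 4 ⨾ 19 ≔ 8 ⊕ 18 ⨾ 19 ≔load 19 ⨾ 21 ≔ 19 ⊖ 17 ⨾
  ifNonzero 21 then skip else (21 ≔ 17 ⊖ 19 ⨾
  ifNonzero 21 then skip else (19 ≔ 7 ⊕ 18 ⨾ 19 ≔load 19 ⨾ 21 ≔ 9 ⊕ 19 ⨾ 21 ≔load 21 ⨾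
  ifNonzero 21 then (21 ≔ 12 ⊕ 19 ⨾ store 21 ≔ 20) else skip))
packStep =
  18 ≔ 18 ⊖ 4 ⨾ 19 ≔ 8 ⊕ 18 ⨾ 19 ≔load 19 ⨾ 21 ≔ 12 ⊕ 19 ⨾ 21 ≔load 21 ⨾ 21 ≔ 20 ⊖ 21 ⨾
  ifNonzero 21 then skip else (22 ≔ 7 ⊕ 18 ⨾ 22 ≔load 22 ⨾ 21 ≔ 22 ⊖ 19 ⨾ 21 ≔ 13 ⊕ 21 ⨾ 21 ≔load 21 ⨾ 21 ≔ 16 ⊖ 21 ⨾
  ifNonzero 21 then skip else (21 ≔ 13 ⊕ 22 ⨾ store 21 ≔ 20))
roundStart = 14 ≔ 14 ⊖ 4 ⨾ 17 ≔const 0 ⨾ 18 ≔copy 1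
stamp = 20 ≔ 4 ⊕ 16 ⨾ 18 ≔copy 6
roundStep =
  roundStart ⨾ whileNonzero 18 loop maskStep ⨾ stamp ⨾ whileNonzero 18 loop suitStep ⨾
  18 ≔copy 6 ⨾ whileNonzero 18 loop packStep ⨾ 16 ≔copy 20
rounds = (16 ≔const 0 ⨾ 14 ≔copy 3) ⨾ whileNonzero 14 loop roundStep
-- The full vertex set has mask `N ∸ 1`, and `1 ∸ (k ∸ a)` is the indicator of `k ≤ a`.
answer = 5 ≔ 5 ⊖ 4 ⨾ 5 ≔ 13 ⊕ 5 ⨾ 5 ≔load 5 ⨾ 5 ≔ 3 ⊖ 5 ⨾ 0 ≔ 4 ⊖ 5

update-≤ : ∀ f a v {b c} → c ≤ v → c ≤ f b → c ≤ update f a v b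
update-≤ f a v {b} {c} c≤v c≤f with b ≟ a
... | yes refl = subst (c ≤_) (sym (update-same f a v)) c≤v
... | no b≢a = subst (c ≤_) (sym (update-other f a v b≢a)) c≤f

≤-update : ∀ f a v {b c} → v ≤ c → f b ≤ c → update f a v b ≤ c
≤-update f a v {b} {c} v≤c f≤c with b ≟ a
... | yes refl = subst (_≤ c) (sym (update-same f a v)) v≤c
... | no b≢a = subst (_≤ c) (sym (update-other f a v b≢a)) f≤c

module Rounds (I : Instance) (W : ℕ) (big : Layout.WordSize I W) where
  open ConnTable I W big public

  record Tables (f₀ f₁ f₂ : ℕ → ℕ) : Set where
    constructor tables
    field
      pairs    : Pairs n f₀ f₁
      sound    : BuiltSound f₂
      complete : ∀ Y → Built Y → f₂ (val Y) ≢ 0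

  -- Whatever number is stored is itself certified, so this survives in the middle of a round, when
  -- some entries are already raised and others are not.
  PackSound : (ℕ → ℕ) → Set
  PackSound f = ∀ Y → Packs (f (val Y)) Y

  PackComplete : ℕ → (ℕ → ℕ) → Set
  PackComplete i f = ∀ Y → Packs i Y → i ≤ f (val Y)

  -- The bound on array 5 says that no stamp of an earlier round can pass for the stamp i + 1 of the
  -- next one.
  RoundInv : ℕ → Post
  RoundInv j vs h = ∃[ i ] i + j ≡ k × (Σ[ s ∈ Vec ℕ 7 ] vs ≡ E (j ∷ termBase + i * n ∷ i ∷ s))
    × Tables (h 0) (h 1) (h 2) × (∀ x → h 5 x ≤ i) × PackSound (h 6) × PackComplete i (h 6)

  module Round (p : Fin k) (x₁ : ℕ) where

    i = toℕ p
    z = val (Z p)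

    val<L : ∀ (Y : Subset n) → val Y < L
    val<L Y = ≤-trans (val<2^ Y) (2^≤3^ n)

    MaskInv : Heap → ℕ → Post
    MaskInv h₁ j vs h = ∃[ q ] q + j ≡ n × (∃[ part ] (Σ[ s ∈ Subset j ]
        (part * 2^ j + val s ≡ z) × (∀ u → χ s u ≡ χ (Z p) (q + u))
      × (Σ[ y ∈ Vec ℕ 5 ] vs ≡ E (x₁ ∷ termBase + i * n + q ∷ i ∷ part ∷ j ∷ y)) × h ≡ h₁))

    -- Horner's rule.
    mask : ∀ h₁ j {vs h} → MaskInv h₁ (suc j) vs h →
           cell vs 18 ≢ 0 × Runs maskStep vs h (cost maskStep) (MaskInv h₁ j)
    mask h₁ j (q , eq , part , b ∷ s , sum , tail , (_ ∷ y , refl) , refl) = (λ ()) , block maskStep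
      ( j , refl , input zp<D , bit b , bit≡ , part + part , refl , double≤W part≤L part≤L
      , part + part + bit b , refl , small≤W part′≤L
      , A + suc q , A+sq , input≤W (≤-trans (≤-reflexive (+-suc A q)) zp<D)
      , suc q , trans (sym (+-suc q j)) eq , part + part + bit b , s , sum′
      , (λ u → trans (tail (suc u)) (cong (χ (Z p)) (+-suc q u))) , (_ , refl) , refl )
      where
      A = termBase + i * n
      q<n : q < n
      q<n = q<q+s eq
      zp<D : A + q < inputSize
      zp<D = begin-strict
        A + q                    <⟨ +-monoʳ-< A q<n ⟩
        A + n                    ≡⟨ trans (+-assoc termBase (i * n) n) (cong (termBase +_) (+-comm (i * n) n)) ⟩
        termBase + suc i * n     ≤⟨ termBase≤ (Fin.toℕ<n p) ⟩
        inputSize                ∎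
        where open ≤-Reasoning
      bit≡ : bit b ≡ cell (encode I) (A + q)
      bit≡ = trans (trans (tail 0) (cong (χ (Z p)) (+-identityʳ q))) (sym (cell-term p q<n))
      A+sq : A + suc q ≡ A + q + 1
      A+sq = trans (+-suc A q) (+-comm 1 (A + q))
      horner : ∀ b P r → (part + part + bit b) * P + r ≡ part * (P + P) + (r + bit b * P)
      horner b P r = lemma part (bit b) P r
        where
        lemma : ∀ a b P r → (a + a + b) * P + r ≡ a * (P + P) + (r + b * P)
        lemma = solve-∀
      val-∷ : ∀ b → val s + bit b * 2^ j ≡ val (b ∷ s)
      val-∷ false = +-identityʳ (val s)
      val-∷ true  = cong (val s +_) (+-identityʳ (2^ j))
      sum′ : (part + part + bit b) * 2^ j + val s ≡ z
      sum′ = trans (horner b (2^ j) (val s)) (trans (cong (part * (2^ j + 2^ j) +_) (val-∷ b)) sum)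
      part′≤L : part + part + bit b ≤ L
      part′≤L = begin
        a′              ≡⟨ *-identityʳ a′ ⟨
        a′ * 1          ≤⟨ *-monoʳ-≤ a′ (1≤2^ j) ⟩
        a′ * 2^ j       ≤⟨ m≤m+n _ (val s) ⟩
        a′ * 2^ j + val s ≡⟨ sum′ ⟩
        z               ≤⟨ <⇒≤ (val<L (Z p)) ⟩
        L               ∎
        where
        open ≤-Reasoning
        a′ = part + part + bit b
      part≤L : part ≤ L
      part≤L = ≤-trans (m≤m+n part _) (≤-trans (m≤m+n (part + part) (bit b)) part′≤L)

    module _ {f₀ f₁ f₂ : ℕ → ℕ} (T : Tables f₀ f₁ f₂) {t : ℕ} (t<L : t < L) where

      d₀ : Vec Digit n
      d₀ = proj₁ (code-surjective n t<L)

      code-d₀ : code d₀ ≡ t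
      code-d₀ = proj₂ (code-surjective n t<L)

      X≡ : ∀ d → code d ≡ t → f₀ t ≡ val (Union d)
      X≡ d eq = trans (cong f₀ (sym eq)) (proj₁ (Tables.pairs T d))

      S≡ : ∀ d → code d ≡ t → f₁ t ≡ val (Sel d)
      S≡ d eq = trans (cong f₁ (sym eq)) (proj₂ (Tables.pairs T d))

      X∸S≡ : ∀ d → code d ≡ t → f₀ t ∸ f₁ t ≡ val (Diff d)
      X∸S≡ d eq = trans (cong₂ _∸_ (trans (X≡ d eq) (val-Diff d)) (S≡ d eq)) (m+n∸n≡m (val (Diff d)) (val (Sel d)))

      X<L : f₀ t < L
      X<L = subst (_< L) (sym (X≡ d₀ code-d₀)) (val<L (Union d₀))

      S<L : f₁ t < L
      S<L = subst (_< L) (sym (S≡ d₀ code-d₀)) (val<L (Sel d₀))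

      X∸S<L : f₀ t ∸ f₁ t < L
      X∸S<L = subst (_< L) (sym (X∸S≡ d₀ code-d₀)) (val<L (Diff d₀))

    SuitSound : (ℕ → ℕ) → Set
    SuitSound f = ∀ x → suc i ≤ f x → ∃[ Y ] val Y ≡ x × Suits p Y

    SuitDone : ℕ → (ℕ → ℕ) → Set
    SuitDone t f = (d : Vec Digit n) → t ≤ code d → Sel d ≡ Z p → Built (Union d) → suc i ≤ f (val (Union d))

    SuitFacts : ℕ → (f₀ f₁ f₂ f₅ f₆ : ℕ → ℕ) → Set
    SuitFacts t f₀ f₁ f₂ f₅ f₆ = Tables f₀ f₁ f₂ × PackSound f₆ × PackComplete i f₆
      × (∀ x → f₅ x ≤ suc i) × SuitSound f₅ × SuitDone t f₅

    loopRegs : ℕ → ℕ → ℕ → Vec ℕ 3 → List ℕ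
    loopRegs zp t a s = E (x₁ ∷ zp ∷ i ∷ z ∷ t ∷ a ∷ suc i ∷ s)

    SuitInv : ℕ → ℕ → Post
    SuitInv zp t vs h = (∃[ a ] ∃[ s ] vs ≡ loopRegs zp t a s) × t ≤ L × SuitFacts t (h 0) (h 1) (h 2) (h 5) (h 6)

    suit : ∀ zp t {vs h} → SuitInv zp (suc t) vs h →
           cell vs 18 ≢ 0 × Runs suitStep vs h (cost suitStep) (SuitInv zp t)
    suit zp t {h = h} ((_ , _ ∷ _ ∷ _ ∷ [] , refl) , t<L , sf@(T , _ , _ , small , sound , done)) = (λ ()) , block suitStep
      ( t , refl , base 1 + t , refl , address 1 t<L , array 1 t t<L , S , refl , S ∸ z , refl
      , (λ nz → finish h refl sf (λ d eq selZ _ → ⊥-elim (nz (m≤n⇒m∸n≡0 (≤-reflexive (S≡z d eq selZ))))))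
      , (λ S∸z → z ∸ S , refl
        , (λ nz → finish h refl sf (λ d eq selZ _ → ⊥-elim (nz (m≤n⇒m∸n≡0 (≤-reflexive (sym (S≡z d eq selZ)))))))
        , (λ z∸S → base 0 + t , refl , address 0 t<L , array 0 t t<L , X , refl
          , base 2 + X , refl , address 2 (X<L T t<L) , array 2 X (X<L T t<L) , h 2 X , refl
          , (λ nz → base 5 + X , refl , address 5 (X<L T t<L) , slot 5 X (X<L T t<L)
              , finish (write h 5 X (suc i)) refl (stamped (≤-antisym (m∸n≡0⇒m≤n S∸z) (m∸n≡0⇒m≤n z∸S)) nz)
                  (λ d eq _ _ → ≤-reflexive (sym (trans (cong (update (h 5) X (suc i)) (sym (X≡ T t<L d eq)))
                                                        (update-same (h 5) X (suc i))))))
          , (λ X0 → finish h refl sf (λ d eq _ built →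
               ⊥-elim (Tables.complete T (Union d) built (trans (cong (h 2) (sym (X≡ T t<L d eq))) X0)))))))
      where
      X S : ℕ
      X = h 0 t
      S = h 1 t
      S≡z : ∀ d → code d ≡ t → Sel d ≡ Z p → S ≡ z
      S≡z d eq selZ = trans (S≡ T t<L d eq) (cong val selZ)
      -- All four branches end here. A branch that stamps nothing refutes one of the premises of
      -- `SuitDone` for the pair with code t.
      finish : ∀ h′ {vs a s} → vs ≡ loopRegs zp t a s → SuitFacts (suc t) (h′ 0) (h′ 1) (h′ 2) (h′ 5) (h′ 6) →
        (∀ d → code d ≡ t → Sel d ≡ Z p → Built (Union d) → suc i ≤ h′ 5 (val (Union d))) → SuitInv zp t vs h′
      finish h′ vs≡ (T , ps , pc , small , sound , done) new = (_ , _ , vs≡) , <⇒≤ t<L , T , ps , pc , small , sound , done′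
        where
        done′ : SuitDone t (h′ 5)
        done′ d t≤ with code d ≟ t
        ... | yes eq = new d eq
        ... | no neq = done d (≤∧≢⇒< t≤ (λ eq → neq (sym eq)))
      stamped : S ≡ z → h 2 X ≢ 0 → SuitFacts (suc t) (h 0) (h 1) (h 2) (update (h 5) X (suc i)) (h 6)
      stamped S≡z nz with sf
      ... | _ , ps , pc , _ = T , ps , pc , (λ x → ≤-update (h 5) X (suc i) ≤-refl (small x)) , sound′
        , λ d t≤ selZ b → update-≤ (h 5) X (suc i) ≤-refl (done d t≤ selZ b)
        where
        d = d₀ T t<L
        suits : Suits p (Union d)
        suits with Tables.sound T X nz
        ... | Y , vY , bY = Built⇒Connected (subst Built (val-injective Y _ (trans vY (X≡ T t<L d (code-d₀ T t<L)))) bY)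
          , λ u∈ → Sel⊆Union d (subst (_ ∈_) (val-injective (Z p) (Sel d) (trans (sym S≡z) (S≡ T t<L d (code-d₀ T t<L)))) u∈)
        sound′ : SuitSound (update (h 5) X (suc i))
        sound′ x i< with x ≟ X
        ... | yes refl = Union d , sym (X≡ T t<L d (code-d₀ T t<L)) , suits
        ... | no x≢X = sound x (subst (suc i ≤_) (update-other (h 5) X (suc i) x≢X) i<)

    SuitComplete : (ℕ → ℕ) → Set
    SuitComplete f = ∀ Y → Suits p Y → suc i ≤ f (val Y)

    suitComplete : ∀ {f} → SuitDone 0 f → SuitComplete f
    suitComplete {f} done Y (conn , Z⊆) with digits Y (Z p) Z⊆
    ... | d , refl , selZ = done d z≤n selZ (Connected⇒Built conn)

    PackDone : ℕ → (ℕ → ℕ) → Set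
    PackDone t f = (d : Vec Digit n) → t ≤ code d → Suits p (Sel d) → Packs i (Diff d) → suc i ≤ f (val (Union d))

    PackFacts : ℕ → (f₀ f₁ f₂ f₅ f₆ : ℕ → ℕ) → Set
    PackFacts t f₀ f₁ f₂ f₅ f₆ = Tables f₀ f₁ f₂ × (∀ x → f₅ x ≤ suc i) × SuitSound f₅ × SuitComplete f₅
      × PackSound f₆ × PackComplete i f₆ × PackDone t f₆

    PackInv : ℕ → ℕ → Post
    PackInv zp t vs h = (∃[ a ] ∃[ s ] vs ≡ loopRegs zp t a s) × t ≤ L × PackFacts t (h 0) (h 1) (h 2) (h 5) (h 6)

    pack : ∀ zp t {vs h} → PackInv zp (suc t) vs h →
           cell vs 18 ≢ 0 × Runs packStep vs h (cost packStep) (PackInv zp t)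
    pack zp t {h = h} ((_ , _ ∷ _ ∷ _ ∷ [] , refl) , t<L , pf@(T , small , ss , sc , ps , pc , done)) = (λ ()) , block packStep
      ( t , refl , base 1 + t , refl , address 1 t<L , array 1 t t<L , S , refl
      , base 5 + S , refl , address 5 (S<L T t<L) , array 5 S (S<L T t<L) , h 5 S , refl , suc i ∸ h 5 S , refl
      , (λ nz → finish h refl pf (λ d eq suits _ →
           ⊥-elim (nz (m≤n⇒m∸n≡0 (subst (λ y → suc i ≤ h 5 y) (sym (S≡ T t<L d eq)) (sc (Sel d) suits))))))
      , (λ ok → base 0 + t , refl , address 0 t<L , array 0 t t<L , X , refl , X ∸ S , refl
        , base 6 + (X ∸ S) , refl , address 6 (X∸S<L T t<L) , array 6 (X ∸ S) (X∸S<L T t<L) , h 6 (X ∸ S) , refl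
        , i ∸ h 6 (X ∸ S) , refl
        , (λ nz → finish h refl pf (λ d eq _ packs →
             ⊥-elim (nz (m≤n⇒m∸n≡0 (subst (λ y → i ≤ h 6 y) (sym (X∸S≡ T t<L d eq)) (pc (Diff d) packs))))))
        , (λ fit → base 6 + X , refl , address 6 (X<L T t<L) , slot 6 X (X<L T t<L)
            , finish (write h 6 X (suc i)) refl (stamped (m∸n≡0⇒m≤n ok) (m∸n≡0⇒m≤n fit))
                (λ d eq _ _ → ≤-reflexive (sym (trans (cong (update (h 6) X (suc i)) (sym (X≡ T t<L d eq)))
                                                      (update-same (h 6) X (suc i))))))))
      where
      X S : ℕ
      X = h 0 t
      S = h 1 t
      finish : ∀ h′ {vs a s} → vs ≡ loopRegs zp t a s → PackFacts (suc t) (h′ 0) (h′ 1) (h′ 2) (h′ 5) (h′ 6) →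
        (∀ d → code d ≡ t → Suits p (Sel d) → Packs i (Diff d) → suc i ≤ h′ 6 (val (Union d))) → PackInv zp t vs h′
      finish h′ vs≡ (T , small , ss , sc , ps , pc , done) new = (_ , _ , vs≡) , <⇒≤ t<L , T , small , ss , sc , ps , pc , done′
        where
        done′ : PackDone t (h′ 6)
        done′ d t≤ with code d ≟ t
        ... | yes eq = new d eq
        ... | no neq = done d (≤∧≢⇒< t≤ (λ eq → neq (sym eq)))
      stamped : suc i ≤ h 5 S → i ≤ h 6 (X ∸ S) → PackFacts (suc t) (h 0) (h 1) (h 2) (h 5) (update (h 6) X (suc i))
      stamped ok fit = T , small , ss , sc , ps′
        -- Whatever value stood at X, the new one is at least i, which is all that `PackComplete i`
        -- asks.
        , (λ Y packs → update-≤ (h 6) X (suc i) (n≤1+n i) (pc Y packs))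
        , (λ d t≤ suits packs → update-≤ (h 6) X (suc i) ≤-refl (done d t≤ suits packs))
        where
        d = d₀ T t<L
        code-d = code-d₀ T t<L
        suits : Suits p (Sel d)
        suits with ss S ok
        ... | Y , vY , sY = subst (Suits p) (val-injective Y _ (trans vY (S≡ T t<L d code-d))) sY
        packs : Packs (suc i) (Union d)
        -- The entry of the difference may exceed i, even because of an update in this very round;
        -- antitonicity still extracts i sets, so updating the array in place is harmless.
        packs = Packs-suc p d suits (Packs-mono (subst (λ y → i ≤ h 6 y) (X∸S≡ T t<L d code-d) fit) (ps (Diff d)))
        ps′ : PackSound (update (h 6) X (suc i))
        ps′ Y with val Y ≟ X
        ... | no Y≢X = subst (λ c → Packs c Y) (sym (update-other (h 6) X (suc i) Y≢X)) (ps Y)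
        ... | yes Y≡X with val-injective Y (Union d) (trans Y≡X (X≡ T t<L d code-d))
        ...   | refl = subst (λ c → Packs c Y) (sym (trans (cong (update (h 6) X (suc i)) Y≡X) (update-same (h 6) X (suc i)))) packs

    packComplete : ∀ {f} → PackDone 0 f → PackComplete (suc i) f
    packComplete done Y packs with Packs-suc⁻¹ p packs
    ... | d , refl , suits , packs′ = done d z≤n suits packs′

  maskTime suitTime packTime roundTime : ℕ
  maskTime  = 1 + n * suc (cost maskStep)
  suitTime  = 1 + L * suc (cost suitStep)
  packTime  = 1 + L * suc (cost packStep)
  roundTime = 3 + (maskTime + (2 + (suitTime + (1 + (packTime + 1)))))

  round : ∀ j {vs h} → RoundInv (suc j) vs h → cell vs 14 ≢ 0 × Runs roundStep vs h roundTime (RoundInv j)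
  -- Matching on the second equation replaces the number i by `toℕ p`, which makes the terminal set
  -- `Z p` available.
  round j (i , eq , s , T , small , ps , pc) with Fin.fromℕ< (q<q+s eq) | Fin.toℕ-fromℕ< (q<q+s eq)
  round j {h = h₁} (_ , eq , (_ ∷ _ ∷ s , refl) , T , small , ps , pc) | p | refl = (λ ()) , seq (block roundStart
    ( j , refl , c≤W z≤n , n , refl
    , seq (consequence (λ {vs} {h} → afterMask {vs} {h})
        (for (MaskInv h₁) (cost maskStep) (λ { (_ , _ , _ , _ , _ , _ , (_ , refl) , _) → refl }) (mask h₁) n
          (0 , refl , 0 , Z p , refl , (λ _ → refl) , (_ , cong (λ zp → E (j ∷ zp ∷ toℕ p ∷ 0 ∷ n ∷ s)) (sym (+-identityʳ _))) , refl)))))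
    where
    open Round p j
    zp = termBase + toℕ p * n + n
    zp≡ : zp ≡ termBase + suc (toℕ p) * n
    zp≡ = trans (+-assoc termBase _ n) (cong (termBase +_) (+-comm (toℕ p * n) n))
    eq′ : suc (toℕ p) + j ≡ k
    eq′ = trans (sym (+-suc (toℕ p) j)) eq
    afterPack : ∀ {vs h} → PackInv zp 0 vs h → Runs (16 ≔copy 20) vs h 1 (RoundInv j)
    afterPack {h = h} ((a , s@(_ ∷ _ ∷ _ ∷ []) , refl) , _ , T , small , _ , _ , ps , _ , done) = block (16 ≔copy 20)
      ( suc (toℕ p) , refl , suc (toℕ p) , eq′
      , (_ , cong (λ zp → E (j ∷ zp ∷ suc (toℕ p) ∷ val (Z p) ∷ 0 ∷ a ∷ suc (toℕ p) ∷ s)) zp≡)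
      , T , small , ps , packComplete {h 6} done )
    afterSuit : ∀ {vs h} → SuitInv zp 0 vs h →
      Runs (18 ≔copy 6 ⨾ whileNonzero 18 loop packStep ⨾ 16 ≔copy 20) vs h (1 + (packTime + 1)) (RoundInv j)
    afterSuit {h = h} ((_ , _ ∷ _ ∷ _ ∷ [] , refl) , _ , T , ps , pc , small , ss , done) = seq (block (18 ≔copy 6)
      (L , refl , seq (consequence (λ {vs} {h} → afterPack {vs} {h})
        (for (PackInv zp) (cost packStep) (λ { ((_ , _ , refl) , _) → refl }) (pack zp) L
          ((_ , _ , refl) , ≤-refl , T , small , ss , suitComplete {h 5} done , ps , pc
          , λ d L≤ → ⊥-elim (<⇒≱ (code<3^ d) L≤))))))
    afterMask : ∀ {vs h} → MaskInv h₁ 0 vs h →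
      Runs (stamp ⨾ whileNonzero 18 loop suitStep ⨾ 18 ≔copy 6 ⨾ whileNonzero 18 loop packStep ⨾ 16 ≔copy 20)
           vs h (2 + (suitTime + (1 + (packTime + 1)))) (RoundInv j)
    afterMask (q , eqn , part , [] , sum , _ , (_ ∷ _ ∷ _ ∷ _ ∷ _ ∷ [] , refl) , refl)
      with trans (sym (+-identityʳ q)) eqn | trans (sym (trans (+-identityʳ _) (*-identityʳ part))) sum
    ... | refl | refl = seq (block stamp
      ( suc (toℕ p) , refl , ≤-trans (Fin.toℕ<n p) k≤W , L , refl
      , seq (consequence (λ {vs} {h} → afterSuit {vs} {h})
        (for (SuitInv zp) (cost suitStep) (λ { ((_ , _ , refl) , _) → refl }) (suit zp) L
          ((_ , _ , refl) , ≤-refl , T , ps , pc , (λ x → m≤n⇒m≤1+n (small x))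
          , (λ x i< → ⊥-elim (<⇒≱ i< (small x))) , λ d L≤ → ⊥-elim (<⇒≱ (code<3^ d) L≤))))))

  Answered : Post
  Answered vs h = (cell vs 0 ≡ 1 × YesInstance I) ⊎ (cell vs 0 ≡ 0 × ¬ YesInstance I)

  RoundsDone : Post
  RoundsDone vs h = (Σ[ s ∈ Vec ℕ 10 ] vs ≡ E s) × PackSound (h 6) × PackComplete k (h 6)

  rounds-runs : ∀ {vs h} → ConnTableDone vs h → Runs rounds vs h (2 + (1 + k * suc roundTime)) RoundsDone
  rounds-runs {h = h} ((_ ∷ s , refl) , connFacts (facts pairs _ sound _ z₅ z₆) complete) = seq (block _ (c≤W z≤n , k , refl ,
    consequence (λ {vs} {h} → done {vs} {h}) (for RoundInv roundTime (λ { (_ , _ , (_ , refl) , _) → refl }) round k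
      (0 , refl , (_ , cong (λ zp → E (k ∷ zp ∷ 0 ∷ s)) (sym (+-identityʳ termBase)))
      , tables pairs sound (λ Y → complete Y (val<2^ Y)) , (λ x → ≤-reflexive (z₅ x))
      , (λ Y → subst (λ c → Packs c Y) (sym (z₆ (val Y))) (Packs-zero Y)) , λ _ _ → z≤n))))
    where
    done : ∀ {vs h} → RoundInv 0 vs h → RoundsDone vs h
    done (i , eq , (_ , refl) , _ , _ , ps , pc) with trans (sym (+-identityʳ i)) eq
    ... | refl = (_ , refl) , ps , pc

  answer-runs : ∀ {vs h} → RoundsDone vs h → Runs answer vs h (cost answer) Answered
  answer-runs {h = h} ((s , refl) , ps , pc) = block answer
    ( N ∸ 1 , refl , base 6 + (N ∸ 1) , refl , address 6 N∸1<L , array 6 (N ∸ 1) N∸1<L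
    , h 6 (N ∸ 1) , refl , k ∸ h 6 (N ∸ 1) , refl , 1 ∸ (k ∸ h 6 (N ∸ 1)) , refl , decide )
    where
    N∸1≡ : N ∸ 1 ≡ val (full {n})
    N∸1≡ = cong (_∸ 1) (sym (val-full n))
    N∸1<L : N ∸ 1 < L
    N∸1<L = subst (_< L) (sym N∸1≡) (≤-trans (val<2^ (full {n})) (2^≤3^ n))
    decide : (1 ∸ (k ∸ h 6 (N ∸ 1)) ≡ 1 × YesInstance I) ⊎ (1 ∸ (k ∸ h 6 (N ∸ 1)) ≡ 0 × ¬ YesInstance I)
    decide rewrite N∸1≡ with k ≤? h 6 (val (full {n}))
    ... | yes k≤ = inj₁ (cong (1 ∸_) (m≤n⇒m∸n≡0 k≤) , Packs⇒Yes (Packs-mono k≤ (ps full)))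
    ... | no k≰ = inj₂ (m≤n⇒m∸n≡0 (m<n⇒0<n∸m (≰⇒> k≰)) , λ yes → k≰ (pc full (Yes⇒Packs yes)))

-- Composition, total time and word size.

solver : Program
solver = setup ⨾ pairTable ⨾ connTable ⨾ rounds ⨾ answer

module Solver (I : Instance) (W : ℕ) (big : Layout.WordSize I W) where
  open Rounds I W big public

  totalTime : ℕ
  totalTime = setupTime + ((3 + pairTableTime n) + ((2 + (1 + N * suc setTime)) + ((2 + (1 + k * suc roundTime)) + 5)))

  solver-runs : Runs solver [] blank totalTime Answered
  solver-runs = seq (consequence (λ {vs} {h} q₁ →
    seq (consequence (λ {vs} {h} q₂ →
    seq (consequence (λ {vs} {h} q₃ →
    seq (consequence (λ {vs} {h} q₄ → answer-runs {vs} {h} q₄)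
      (rounds-runs {vs} {h} q₃))) (connTable-runs {vs} {h} q₂))) (pairTable-runs {vs} {h} q₁))) setup-runs)

  -- Cells beyond the input read 0, so the arrays need no initialisation: 0 means not known to be
  -- connected, never suitable, and no terminal set served.
  initial-represents : Represents (initial I) [] blank
  initial-represents = represents (λ _ → refl) (λ _ _ → refl)
    (λ a i _ → cell-beyond (encode I) (≤-trans (≤-reflexive length-encode) (D≤base a i)))

  module _ {t : ℕ} (N≤ : N ≤ t) (Nn≤ : N * n ≤ 2 * t) (Nm≤ : N * m ≤ t) (L≤ : L ≤ t) (Lk≤ : L * k ≤ t) where

    1≤L : 1 ≤ L
    1≤L = ≤-trans (s≤s z≤n) n<L

    1≤t : 1 ≤ t
    1≤t = ≤-trans 1≤L L≤

    const≤ : ∀ c → c ≤ c * t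
    const≤ c = ≤-trans (≤-reflexive (sym (*-identityʳ c))) (*-monoʳ-≤ c 1≤t)

    n≤t : n ≤ t
    n≤t = ≤-trans (<⇒≤ n<L) L≤

    k≤t : k ≤ t
    k≤t = ≤-trans (≤-trans (≤-reflexive (sym (*-identityˡ k))) (*-monoˡ-≤ k 1≤L)) Lk≤

    setup≤ : setupTime ≤ 31 * t
    setup≤ = begin
      setupTime                      ≡⟨ lemma k n ⟩
      23 + (3 * k + 5 * n)           ≤⟨ +-mono-≤ (const≤ 23) (+-mono-≤ (*-monoʳ-≤ 3 k≤t) (*-monoʳ-≤ 5 n≤t)) ⟩
      23 * t + (3 * t + 5 * t)       ≡⟨ lemma′ t ⟩
      31 * t                         ∎
      where
      open ≤-Reasoning
      lemma : ∀ k n → 12 + ((1 + k * 3) + (3 + ((1 + n * 5) + 6))) ≡ 23 + (3 * k + 5 * n)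
      lemma = solve-∀
      lemma′ : ∀ t → 23 * t + (3 * t + 5 * t) ≡ 31 * t
      lemma′ = solve-∀

    pairTable≤ : 3 + pairTableTime n ≤ 19 * t
    pairTable≤ = begin
      4 + 15 * (L ∸ 3^ (n ∸ n))  ≤⟨ +-mono-≤ (const≤ 4) (*-monoʳ-≤ 15 (≤-trans (m∸n≤m L (3^ (n ∸ n))) L≤)) ⟩
      4 * t + 15 * t             ≡⟨ *-distribʳ-+ t 4 15 ⟨
      19 * t                     ∎
      where open ≤-Reasoning

    connTable≤ : 2 + (1 + N * suc setTime) ≤ 62 * t
    connTable≤ = begin
      2 + (1 + N * suc setTime)                       ≡⟨ lemma N n m ⟩
      3 + (9 * N + (10 * (N * n) + 30 * (N * m)))
        ≤⟨ +-mono-≤ (const≤ 3) (+-mono-≤ (*-monoʳ-≤ 9 N≤) (+-mono-≤ (*-monoʳ-≤ 10 Nn≤) (*-monoʳ-≤ 30 Nm≤))) ⟩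
      3 * t + (9 * t + (10 * (2 * t) + 30 * t))       ≡⟨ lemma′ t ⟩
      62 * t                                          ∎
      where
      open ≤-Reasoning
      lemma : ∀ N n m → 2 + (1 + N * suc (4 + ((1 + n * 10) + (1 + ((1 + m * 30) + 1)))))
                      ≡ 3 + (9 * N + (10 * (N * n) + 30 * (N * m)))
      lemma = solve-∀
      lemma′ : ∀ t → 3 * t + (9 * t + (10 * (2 * t) + 30 * t)) ≡ 62 * t
      lemma′ = solve-∀

    rounds≤ : 2 + (1 + k * suc roundTime) ≤ 52 * t
    rounds≤ = begin
      2 + (1 + k * suc roundTime)             ≡⟨ lemma k n L ⟩
      3 + (11 * (1 * k) + (6 * (n * k) + 32 * (L * k)))
        ≤⟨ +-mono-≤ (const≤ 3) (+-mono-≤ (*-monoʳ-≤ 11 (≤-trans (*-monoˡ-≤ k 1≤L) Lk≤))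
             (+-mono-≤ (*-monoʳ-≤ 6 (≤-trans (*-monoˡ-≤ k (<⇒≤ n<L)) Lk≤)) (*-monoʳ-≤ 32 Lk≤))) ⟩
      3 * t + (11 * t + (6 * t + 32 * t))     ≡⟨ lemma′ t ⟩
      52 * t                                  ∎
      where
      open ≤-Reasoning
      lemma : ∀ k n L → 2 + (1 + k * suc (3 + ((1 + n * 6) + (2 + ((1 + L * 15) + (1 + ((1 + L * 17) + 1)))))))
                      ≡ 3 + (11 * (1 * k) + (6 * (n * k) + 32 * (L * k)))
      lemma = solve-∀
      lemma′ : ∀ t → 3 * t + (11 * t + (6 * t + 32 * t)) ≡ 52 * t
      lemma′ = solve-∀

    total≤ : totalTime ≤ 169 * t
    total≤ = begin
      totalTime  ≤⟨ +-mono-≤ setup≤ (+-mono-≤ pairTable≤ (+-mono-≤ connTable≤ (+-mono-≤ rounds≤ (const≤ 5)))) ⟩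
      31 * t + (19 * t + (62 * t + (52 * t + 5 * t)))  ≡⟨ lemma t ⟩
      169 * t    ∎
      where
      open ≤-Reasoning
      lemma : ∀ t → 31 * t + (19 * t + (62 * t + (52 * t + 5 * t))) ≡ 169 * t
      lemma = solve-∀

module _ (I : Instance) where
  open Instance I
  open Logic I

  private
    t = 3ⁿkm I

  factor≤ : ∀ {x y z} → x ≤ 3^ n → y ≤ k ⊔ 1 → z ≤ m ⊔ 1 → x * y * z ≤ t
  factor≤ x≤ y≤ z≤ = *-mono-≤ (*-mono-≤ (≤-trans x≤ (≤-reflexive (3^≡3^ n))) y≤) z≤

  one≤ : ∀ a → 1 ≤ a ⊔ 1
  one≤ a = m≤n⊔m a 1

  L≤t : ∀ {x} → x ≤ 3^ n → x ≤ t
  L≤t {x} x≤ = ≤-trans (≤-reflexive (sym (trans (*-identityʳ _) (*-identityʳ x)))) (factor≤ x≤ (one≤ k) (one≤ m))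

  Lk≤t : ∀ {x} → x ≤ 3^ n → x * k ≤ t
  Lk≤t {x} x≤ = ≤-trans (≤-reflexive (sym (*-identityʳ _))) (factor≤ x≤ (m≤m⊔n k 1) (one≤ m))

  Lm≤t : ∀ {x} → x ≤ 3^ n → x * m ≤ t
  Lm≤t {x} x≤ = ≤-trans (≤-reflexive (cong (_* m) (sym (*-identityʳ x)))) (factor≤ x≤ (one≤ k) (m≤m⊔n m 1))

  1≤3^n : 1 ≤ 3^ n
  1≤3^n = ≤-trans (1≤2^ n) (2^≤3^ n)

  n≤3^n : n ≤ 3^ n
  n≤3^n = ≤-trans (<⇒≤ (v<2^ n)) (2^≤3^ n)

  module _ (W : ℕ) (15t≤W : 15 * t ≤ W) where

    wordSize : Layout.WordSize I W
    wordSize = begin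
      k + Layout.base I W 8                                        ≡⟨ lemma k m n (3^ n) ⟩
      3 * 1 + (1 * k + (2 * (1 * m) + (n * k + 8 * 3^ n)))
        -- The 15 collects 3 header cells, k, the 2m endpoints, the nk characteristic bits and eight
        -- array lengths.
        ≤⟨ +-mono-≤ (*-monoʳ-≤ 3 (L≤t 1≤3^n)) (+-mono-≤ (Lk≤t 1≤3^n) (+-mono-≤ (*-monoʳ-≤ 2 (Lm≤t 1≤3^n))
             (+-mono-≤ (Lk≤t n≤3^n) (*-monoʳ-≤ 8 (L≤t ≤-refl))))) ⟩
      3 * t + (t + (2 * t + (t + 8 * t)))                          ≡⟨ lemma′ t ⟩
      15 * t                                                       ≤⟨ 15t≤W ⟩
      W                                                            ∎
      where
      open ≤-Reasoning
      lemma : ∀ k m n L → k + (3 + m + m + k * n + L + L + L + L + L + L + L + L)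
                        ≡ 3 * 1 + (1 * k + (2 * (1 * m) + (n * k + 8 * L)))
      lemma = solve-∀
      lemma′ : ∀ t → 3 * t + (t + (2 * t + (t + 8 * t))) ≡ 15 * t
      lemma′ = solve-∀

    open Solver I W wordSize using (Represents; Heap; Answered; module Represents; module Halts; solver-runs; initial-represents; total≤)

    correct : ∀ {σ vs h} → Represents σ vs h → Answered vs h → CorrectAnswer I σ
    correct ρ (inj₁ (eq , y)) = inj₁ (trans (Represents.regs ρ 0) eq , y)
    correct ρ (inj₂ (eq , y)) = inj₂ (trans (Represents.regs ρ 0) eq , y)

    solves : ∃[ s ] ∃[ τ ] (W ⊢⟨ solver , initial I ⟩⇓⟨ s , τ ⟩) × s ≤ 169 * t × CorrectAnswer I τ
    solves = time , final , runs , ≤-trans bound (total≤ (L≤t (2^≤3^ n)) N*n≤2t (Lm≤t (2^≤3^ n)) (L≤t ≤-refl) (Lk≤t ≤-refl))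
      , correct {h = heap} repr post
      where
      open Halts (solver-runs (initial I) initial-represents)
      N*n≤2t : 2^ n * n ≤ 2 * t
      N*n≤2t = ≤-trans (2^v*v≤2*3^v n) (+-mono-≤ (L≤t ≤-refl) (≤-trans (L≤t ≤-refl) (m≤m+n t 0)))

theorem6p2 : ∃[ P ] SolvesInTimeO P 3ⁿkm
-- 169 is the sum of the time constants of the five phases; words need only the factor 15, and 154
-- is the difference.
theorem6p2 = solver , 169 , λ I → solves I (169 * 3ⁿkm I) (*-monoˡ-≤ (3ⁿkm I) (m≤m+n 15 154))
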